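{- Let $n\in\mathbb N$ and let $x>0$ with $x\in\mathcal D_n\setminus\bigcup_{k=1}^{n-1}\mathcal D_k$. Then $q_s(x)\in(q_{n-1},q_n]$, and $q_s(x)$ is the root $q\in(q_{n-1},q_n]$ of the equation $$x=\sum_{i=1}^\infty\frac{\gamma_i}{q^i},$$ where $(\gamma_i)$ is the lexicographically smallest sequence in $\mathcal U_{q_n}'$ such that $((\gamma_i))_{q_{n-1}}>x$.
   Context: $\mathbb N=\{1,2,\dots\}$. For a sequence $(d_i)=d_1d_2\cdots$ of zeros and ones and a real $q\ge1$ write $((d_i))_q:=\sum_{i=1}^\infty d_i q^{ -i}$ (for $q=1$ this is the possibly infinite value $\sum_i d_i\in[0,+\infty]$). For $q\in(1,2)$, $(d_i)\in\{0,1\}^{\mathbb N}$ is a $q$-expansion of $x$ if $x=((d_i))_q$. For $x>0$ let $\mathcal U(x)$ be the set of $q\in(1,2)$ such that $x$ has exactly one $q$-expansion, and $q_s(x):=\inf\mathcal U(x)$. For $q\in(1,2)$ let $\mathcal U_q$ be the set of $x\in[0,1/(q-1)]$ having exactly one $q$-expansion, and let $\mathcal U_q'\subset\{0,1\}^{\mathbb N}$ be the set of the corresponding (unique) $q$-expansions. Let $(\tau_i)_{i\ge0}$ be the classical Thue–Morse sequence: $\tau_0=0$, $\tau_{2^m}=1$ for $m\ge0$, and $\tau_{2^m+j}=1-\tau_j$ for $1\le j<2^m$. Let $q_0=1$ and, for $n\ge1$, let $q_n\in(1,2)$ be the root of $1=\sum_{i=1}^{2^n}\tau_i q^{ -i}$;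 the sequence $(q_n)$ is strictly increasing. For $n\in\mathbb N$ put $\mathcal D_n:=\bigcup_{q_{n-1}<q\le q_n}\mathcal U_q$. Sequences are compared lexicographically. -}

module Defs where

open import Algebra.Bundles using (CommutativeRing)
import Algebra.Properties.CommutativeMonoid.Sum as Summation
import Algebra.Properties.Semiring.Exp as Exponentiation
open import Data.Bool using (Bool; true; false; not; if_then_else_; T)
import Data.Bool as Bool
open import Data.Bool.Properties using (T-≡; ¬-not)
open import Data.Fin using (toℕ)
open import Data.Nat as ℕ using (ℕ; zero; suc; pred; _∸_; _<ᵇ_; z≤n; s≤s)
import Data.Nat.Properties as ℕ
open import Data.Product using (∃; ∃!; ∃-syntax; _×_; _,_)
open import Data.Sum using (_⊎_; inj₁; inj₂)
open import Function using (Congruent; Equivalence)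
open import Level using (0ℓ) renaming (suc to lsuc)
open import Relation.Binary using (Rel; IsStrictTotalOrder)
import Relation.Binary.Construct.Add.Supremum.Strict as AddSupremum
import Relation.Binary.Construct.StrictToNonStrict as StrictToNonStrict
open import Relation.Binary.PropositionalEquality
  using (_≡_; _≗_; refl; sym; trans; cong)
open import Relation.Nullary using (¬_)
open import Relation.Nullary.Construct.Add.Supremum using (_⁺; [_]; ⊤⁺)
open import Relation.Unary using (Pred; _∈_)

module Bounds {A : Set} (_≤_ : Rel A 0ℓ) where
  UpperBound LowerBound : Pred A 0ℓ → Pred A 0ℓ
  UpperBound P u = ∀ {x} → x ∈ P → x ≤ u
  LowerBound P l = ∀ {x} → x ∈ P → l ≤ x

  IsSupremum IsInfimum : Pred A 0ℓ → Pred A 0ℓ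
  IsSupremum P s = s ∈ UpperBound P × (∀ {u} → u ∈ UpperBound P → s ≤ u)
  IsInfimum  P s = s ∈ LowerBound P × (∀ {l} → l ∈ LowerBound P → l ≤ s)

-- Axioms of the classical real line.  Such a structure is unique up to
-- isomorphism.  The value of 0# ⁻¹ is unspecified.
record CompleteOrderedField : Set (lsuc 0ℓ) where
  infix 4 _<_
  infix 8 _⁻¹
  field
    commutativeRing : CommutativeRing 0ℓ 0ℓ
  open CommutativeRing commutativeRing public
  field
    _⁻¹                : Carrier → Carrier
    ⁻¹-cong            : Congruent _≈_ _≈_ _⁻¹
    ⁻¹-inverseˡ        : ∀ x → ¬ (x ≈ 0#) → x ⁻¹ * x ≈ 1#
    _<_                : Rel Carrier 0ℓ
    isStrictTotalOrder : IsStrictTotalOrder _≈_ _<_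
    0<1                : 0# < 1#
    +-monoˡ-<          : ∀ z {x y} → x < y → x + z < y + z
    *-pos              : ∀ {x y} → 0# < x → 0# < y → 0# < x * y

  open StrictToNonStrict _≈_ _<_ public using (_≤_)

  open Bounds _≤_ public

  field
    complete : (P : Pred Carrier 0ℓ) → ∃ P → ∃ (UpperBound P) → ∃ (IsSupremum P)

-- The sequence d₁ d₂ ⋯ is represented by the function i ↦ dᵢ₊₁.
BinarySeq : Set
BinarySeq = ℕ → Bool

infix 4 _<ₗₑₓ_ _≤ₗₑₓ_

_<ₗₑₓ_ _≤ₗₑₓ_ : Rel BinarySeq 0ℓ
c <ₗₑₓ d = ∃[ k ] (∀ i → i ℕ.< k → c i ≡ d i) × c k Bool.< d k
c ≤ₗₑₓ d = c <ₗₑₓ d ⊎ c ≗ d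

IsLexSmallest : Pred BinarySeq 0ℓ → Pred BinarySeq 0ℓ
IsLexSmallest S c = c ∈ S × (∀ d → d ∈ S → c ≤ₗₑₓ d)

-- thueMorseBlock m agrees with the Thue–Morse sequence on indices below 2 ^ m.
thueMorseBlock : ℕ → ℕ → Bool
thueMorseBlock zero    _ = false
thueMorseBlock (suc m) i =
  if i <ᵇ 2 ℕ.^ m then thueMorseBlock m i else not (thueMorseBlock m (i ∸ 2 ℕ.^ m))

τ : ℕ → Bool
τ i = thueMorseBlock i i

-- τ satisfies the recursion that defines the Thue–Morse sequence:
-- see τ-zero, τ-2^m and τ-2^m+j.
private
  i<2^i : ∀ i → i ℕ.< 2 ℕ.^ i
  i<2^i zero    = s≤s z≤n
  i<2^i (suc i) = ℕ.≤-trans (ℕ.+-mono-≤ (ℕ.m^n>0 2 i) (i<2^i i))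
    (ℕ.≤-reflexive (cong (2 ℕ.^ i ℕ.+_) (sym (ℕ.+-identityʳ _))))

  block-low : ∀ m {i} → i ℕ.< 2 ℕ.^ m → thueMorseBlock (suc m) i ≡ thueMorseBlock m i
  block-low m {i} i< rewrite Equivalence.to T-≡ (ℕ.<⇒<ᵇ i<) = refl

  block-high : ∀ m j → thueMorseBlock (suc m) (2 ℕ.^ m ℕ.+ j) ≡ not (thueMorseBlock m j)
  block-high m j
    rewrite ¬-not {2 ℕ.^ m ℕ.+ j <ᵇ 2 ℕ.^ m} {true}
              (λ e → ℕ.m+n≮m (2 ℕ.^ m) j (ℕ.<ᵇ⇒< _ _ (Equivalence.from T-≡ e)))
          | ℕ.m+n∸m≡n (2 ℕ.^ m) j = refl

  block-+ : ∀ k m {i} → i ℕ.< 2 ℕ.^ m → thueMorseBlock (k ℕ.+ m) i ≡ thueMorseBlock m i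
  block-+ zero    m i< = refl
  block-+ (suc k) m i< =
    trans (block-low (k ℕ.+ m) (ℕ.<-≤-trans i< (ℕ.^-monoʳ-≤ 2 (ℕ.m≤n+m m k)))) (block-+ k m i<)

  block-τ : ∀ m {i} → i ℕ.< 2 ℕ.^ m → thueMorseBlock m i ≡ τ i
  block-τ m {i} i< = trans (sym (block-+ i m i<))
    (trans (cong (λ k → thueMorseBlock k i) (ℕ.+-comm i m)) (block-+ m i (i<2^i i)))

τ-zero : τ 0 ≡ false
τ-zero = refl

τ-2^m+j : ∀ m j → j ℕ.< 2 ℕ.^ m → τ (2 ℕ.^ m ℕ.+ j) ≡ not (τ j)
τ-2^m+j m j j< = trans
  (sym (block-τ (suc m)
    (ℕ.<-≤-trans (ℕ.+-monoʳ-< (2 ℕ.^ m) j<)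
      (ℕ.≤-reflexive (cong (2 ℕ.^ m ℕ.+_) (sym (ℕ.+-identityʳ _)))))))
  (trans (block-high m j) (cong not (block-τ m j<)))

τ-2^m : ∀ m → τ (2 ℕ.^ m) ≡ true
τ-2^m m = trans (cong τ (sym (ℕ.+-identityʳ (2 ℕ.^ m)))) (τ-2^m+j m 0 (ℕ.m^n>0 2 m))

module Expansions (R : CompleteOrderedField) where
  open CompleteOrderedField R public
    using (Carrier; _≈_; _<_; _≤_; 0#; 1#; _+_; _*_; _-_; _⁻¹; IsInfimum)
  open CompleteOrderedField R using (semiring; +-commutativeMonoid)
  open Exponentiation semiring using (_^_)
  open Summation +-commutativeMonoid using (sum-syntax)
  open AddSupremum _<_ public using (_<⁺_)

  2# : Carrier
  2# = 1# + 1#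

  digit : Bool → Carrier
  digit b = if b then 1# else 0#

  -- d₁ q⁻¹ + ⋯ + d_N q⁻ᴺ
  partialSum : BinarySeq → Carrier → ℕ → Carrier
  partialSum d q N = ∑[ i < N ] (digit (d (toℕ i)) * (q ^ suc (toℕ i)) ⁻¹)

  -- HasValue d q v says that ((d))_q = v, where v is a real or ⊤⁺ = +∞.
  HasValue : BinarySeq → Carrier → Carrier ⁺ → Set
  HasValue d q [ v ] = ∀ ε → 0# < ε →
    ∃[ N ] ∀ m → N ℕ.≤ m → v - ε < partialSum d q m × partialSum d q m < v + ε
  HasValue d q ⊤⁺    = ∀ b → ∃[ N ] ∀ m → N ℕ.≤ m → b < partialSum d q m

  IsExpansion : Carrier → Carrier → Pred BinarySeq 0ℓ
  IsExpansion q x d = HasValue d q [ x ]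

  HasUniqueExpansion : Carrier → Carrier → Set
  HasUniqueExpansion q x = ∃! _≗_ (IsExpansion q x)

  -- 𝒰(x)
  UniqueBases : Carrier → Pred Carrier 0ℓ
  UniqueBases x q = 1# < q × q < 2# × HasUniqueExpansion q x

  -- 𝒰_q and 𝒰′_q, meaningful for 1# < q < 2#
  𝒰 : Carrier → Pred Carrier 0ℓ
  𝒰 q x = 0# ≤ x × x ≤ (q - 1#) ⁻¹ × HasUniqueExpansion q x

  𝒰′ : Carrier → Pred BinarySeq 0ℓ
  𝒰′ q d = ∃[ x ] x ∈ 𝒰 q × IsExpansion q x d

  -- The conditions defining the sequence q₀, q₁, q₂, …
  record IsCriticalBases (q : ℕ → Carrier) : Set where
    field
      q₀≈1 : q 0 ≈ 1#
      1<qₙ : ∀ n → 1 ℕ.≤ n → 1# < q n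
      qₙ<2 : ∀ n → 1 ℕ.≤ n → q n < 2#
      root : ∀ n → 1 ℕ.≤ n → 1# ≈ partialSum (λ i → τ (suc i)) (q n) (2 ℕ.^ n)

  module _ (q : ℕ → Carrier) where

    -- p ∈ (qₙ₋₁ , qₙ], for n ≥ 1
    Window : ℕ → Pred Carrier 0ℓ
    Window n p = q (pred n) < p × p ≤ q n

    𝒟 : ℕ → Pred Carrier 0ℓ
    𝒟 n x = ∃[ p ] p ∈ Window n × x ∈ 𝒰 p

    -- The sequences d ∈ 𝒰′_{qₙ} with ((d))_{qₙ₋₁} > x
    Candidate : ℕ → Carrier → Pred BinarySeq 0ℓ
    Candidate n x d = d ∈ 𝒰′ (q n) × ∃[ v ] HasValue d (q (pred n)) v × [ x ] <⁺ v

module Submission where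

-- Write n = j + 1 and let α be the periodic sequence (τ₁ ⋯ τ_{2ʲ-1} 0)^∞, for j ≥ 1 the quasi-greedy
-- expansion of 1 in base q_j.  Call a sequence admissible if every tail that follows a 0, in the
-- sequence and in its complement, is lexicographically at most α.  For every base
-- t ∈ (q_j , q_{j+1}] the unique expansions are exactly the admissible sequences: in an admissible
-- sequence such tails have value at most 1 in base q_j, hence less than 1 in base t, and this
-- makes the expansion unique; conversely the tails of a unique expansion have value less than 1,
-- hence lie below the quasi-greedy expansion of 1 in base q_{j+1}, and the block structure of the
-- Thue–Morse sequence then bounds them by α.  Admissibility is a closed condition that does not
-- depend on t, and on admissible sequences the value in base t is increasing.  The lexicographic
-- infimum γ of the candidates is itself a candidate: otherwise x would be the value of γ in base
-- q_j, and γ, a limit from above of admissible sequences, would satisfy the tail conditions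
-- strictly and so be a unique expansion in base q_j, against the hypothesis on x.  Since the
-- expansion of x in any base t of the window is at least γ, the value of γ there is at most x;
-- it exceeds x at q_j, and it decreases continuously, so the base where it equals x is the
-- smallest one.

open import Defs
open import Algebra.Solver.Ring.AlmostCommutativeRing
  using (fromCommutativeRing; _-Raw-AlmostCommutative⟶_)
import Algebra.Properties.Ring as RingProperties
import Algebra.Properties.Semiring.Exp as Exponentiation
import Algebra.Properties.Semiring.Mult.TCOptimised as Multiplication
import Algebra.Properties.Semiring.Sum as Summation
import Algebra.Solver.Ring
open import Axiom.ExcludedMiddle using (ExcludedMiddle)
open import Data.Bool using (Bool; true; false; not)
import Data.Bool as Bool
open import Data.Bool.Properties using (not-involutive)
open import Data.Fin using (toℕ)
open import Data.Integer as ℤ using (ℤ; +_; -[1+_]; _⊖_)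
import Data.Integer.Properties as ℤ
open import Data.Maybe using (Maybe; just; nothing)
open import Data.Nat as ℕ using (ℕ; zero; suc; _∸_; z≤n; s≤s)
import Data.Nat.Properties as ℕ
open import Data.Product using (∃; ∃-syntax; _×_; _,_; proj₁; proj₂)
open import Data.Sum using (_⊎_; inj₁; inj₂)
open import Function using (_∘_)
open import Level using (0ℓ)
open import Relation.Binary using (tri<; tri≈; tri>; IsStrictTotalOrder; StrictPartialOrder)
open import Relation.Binary.Construct.Add.Supremum.Strict using ([_]; [_]<⊤⁺)
import Relation.Binary.Construct.StrictToNonStrict as StrictToNonStrict
open import Relation.Binary.PropositionalEquality as ≡ using (_≡_; _≗_)
import Relation.Binary.Reasoning.Setoid as SetoidReasoning
import Relation.Binary.Reasoning.StrictPartialOrder as StrictReasoning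
open import Relation.Nullary using (¬_; yes; no; contradiction; decidable-stable)
open import Relation.Nullary.Construct.Add.Supremum using ([_]; ⊤⁺)
open import Relation.Unary using (Pred; _∈_; _∉_)


-- Binary sequences and the lexicographic order

private variable
  c d α : BinarySeq
  k m n : ℕ

shift : ℕ → BinarySeq → BinarySeq
shift k d i = d (k ℕ.+ i)

shift-suc : ∀ k d → shift k d ∘ suc ≗ shift (suc k) d
shift-suc k d i = ≡.cong d (ℕ.+-suc k i)

shift-zero : ∀ k d → shift k d 0 ≡ d k
shift-zero k d = ≡.cong d (ℕ.+-identityʳ k)

flip : BinarySeq → BinarySeq
flip d = not ∘ d

infixr 5 _∷_
_∷_ : Bool → BinarySeq → BinarySeq
(b ∷ d) zero    = b
(b ∷ d) (suc i) = d i

Agree : ℕ → BinarySeq → BinarySeq → Set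
Agree k c d = ∀ i → i ℕ.< k → c i ≡ d i

Agree-tail : Agree (suc k) c d → Agree k (c ∘ suc) (d ∘ suc)
Agree-tail eq i i<k = eq (suc i) (s≤s i<k)

Agree-∷ : c 0 ≡ d 0 → Agree k (c ∘ suc) (d ∘ suc) → Agree (suc k) c d
Agree-∷ eq₀ eq zero    _         = eq₀
Agree-∷ eq₀ eq (suc i) (s≤s i<k) = eq i i<k

Agree-≤ : m ℕ.≤ n → Agree n c d → Agree m c d
Agree-≤ m≤n eq i i<m = eq i (ℕ.<-≤-trans i<m m≤n)

false≢true : ∀ {b} → b ≡ false → ¬ b ≡ true
false≢true ≡.refl ()

f<t : ∀ {b b′} → b ≡ false → b′ ≡ true → b Bool.< b′
f<t ≡.refl ≡.refl = Bool.f<t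

<⇒false : ∀ {b b′} → b Bool.< b′ → b ≡ false
<⇒false Bool.f<t = ≡.refl

<⇒true : ∀ {b b′} → b Bool.< b′ → b′ ≡ true
<⇒true Bool.f<t = ≡.refl

bool-split : ∀ b → b ≡ false ⊎ b ≡ true
bool-split false = inj₁ ≡.refl
bool-split true  = inj₂ ≡.refl

<ₗₑₓ-irrefl : c ≗ d → ¬ c <ₗₑₓ d
<ₗₑₓ-irrefl eq (k , _ , lt) = false≢true (≡.trans (≡.sym (eq k)) (<⇒false lt)) (<⇒true lt)

<ₗₑₓ-resp : ∀ {c′ d′} → c ≗ c′ → d ≗ d′ → c <ₗₑₓ d → c′ <ₗₑₓ d′
<ₗₑₓ-resp p q (k , eq , lt) =
  k , (λ i i<k → ≡.trans (≡.sym (p i)) (≡.trans (eq i i<k) (q i))) ,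
  ≡.subst₂ Bool._<_ (p k) (q k) lt

<ₗₑₓ-∷ : c 0 ≡ d 0 → c ∘ suc <ₗₑₓ d ∘ suc → c <ₗₑₓ d
<ₗₑₓ-∷ eq₀ (k , eq , lt) = suc k , Agree-∷ eq₀ eq , lt

<ₗₑₓ-shift : ∀ k → Agree k c d → c <ₗₑₓ d → shift k c <ₗₑₓ shift k d
<ₗₑₓ-shift zero    _  lt = lt
<ₗₑₓ-shift (suc k) eq (zero  , _ , lt) =
  contradiction (<⇒true lt) (false≢true (≡.trans (≡.sym (eq 0 (s≤s z≤n))) (<⇒false lt)))
<ₗₑₓ-shift (suc k) eq (suc l , eq′ , lt) =
  <ₗₑₓ-shift k (Agree-tail eq) (l , Agree-tail eq′ , lt)

<ₗₑₓ-asym : c <ₗₑₓ d → ¬ d <ₗₑₓ c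
<ₗₑₓ-asym (k , eq , lt) (l , eq′ , lt′) with ℕ.<-cmp k l
... | tri< k<l _ _ = false≢true (<⇒false lt) (≡.trans (≡.sym (eq′ k k<l)) (<⇒true lt))
... | tri> _ _ l<k = false≢true (<⇒false lt′) (≡.trans (≡.sym (eq l l<k)) (<⇒true lt′))
... | tri≈ _ ≡.refl _ = false≢true (<⇒false lt) (<⇒true lt′)

<ₗₑₓ-flip : c <ₗₑₓ d → flip d <ₗₑₓ flip c
<ₗₑₓ-flip (k , eq , lt) =
  k , (λ i i<k → ≡.cong not (≡.sym (eq i i<k))) ,
  f<t (≡.cong not (<⇒true lt)) (≡.cong not (<⇒false lt))

flip-flip : flip (flip d) ≗ d
flip-flip {d} i = not-involutive (d i)

private
  least-difference : ∀ N → Agree N c d ⊎ ∃[ k ] Agree k c d × ¬ c k ≡ d k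
  least-difference zero = inj₁ λ _ ()
  least-difference {c} {d} (suc N) with c 0 Bool.≟ d 0
  ... | no  ≢ = inj₂ (0 , (λ _ ()) , ≢)
  ... | yes eq₀ with least-difference {c ∘ suc} {d ∘ suc} N
  ...   | inj₁ eq           = inj₁ (Agree-∷ eq₀ eq)
  ...   | inj₂ (k , eq , ≢) = inj₂ (suc k , Agree-∷ eq₀ eq , ≢)

-- Excluded middle only decides whether the sequences differ somewhere. The first difference is then
-- found by a search up to the place supplied.
lex-compare : ExcludedMiddle 0ℓ → ∀ c d → c ≗ d ⊎ c <ₗₑₓ d ⊎ d <ₗₑₓ c
lex-compare em c d with em {∃[ i ] ¬ c i ≡ d i}
... | no none = inj₁ λ i → decidable-stable (c i Bool.≟ d i) λ ≢ → none (i , ≢)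
... | yes (i , ≢) with least-difference {c} {d} (suc i)
...   | inj₁ eq = contradiction (eq i ℕ.≤-refl) ≢
...   | inj₂ (k , eq , ≢) with bool-split (c k) | bool-split (d k)
...     | inj₁ p | inj₁ q = contradiction (≡.trans p (≡.sym q)) ≢
...     | inj₁ p | inj₂ q = inj₂ (inj₁ (k , eq , f<t p q))
...     | inj₂ p | inj₁ q = inj₂ (inj₂ (k , (λ i i<k → ≡.sym (eq i i<k)) , f<t q p))
...     | inj₂ p | inj₂ q = contradiction (≡.trans p (≡.sym q)) ≢

-- Tail conditions

ZeroTails : BinarySeq → Pred BinarySeq 0ℓ
ZeroTails α d = ∀ k → d k ≡ false → ¬ α <ₗₑₓ shift (suc k) d

ZeroTails-shift : ∀ l → ZeroTails α d → ZeroTails α (shift l d)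
ZeroTails-shift zero    ok = ok
ZeroTails-shift (suc l) ok = ZeroTails-shift l (λ k → ok (suc k))

Admissible : BinarySeq → Pred BinarySeq 0ℓ
Admissible α d = ZeroTails α d × ZeroTails α (flip d)

-- A violation shows in a finite prefix: the 0 at place k and the tail behind it up to its first
-- difference from `α`. Any `c` agreeing with `d` that far would share the violation.
ZeroTails-closed : (∀ k → ∃[ c ] ZeroTails α c × Agree k d c) → ZeroTails α d
ZeroTails-closed {α} {d} approx k dₖ≡0 (l , eq , lt) with approx (suc k ℕ.+ suc l)
... | c , ok , agree = ok k
  (≡.trans (≡.sym (agree k (s≤s (ℕ.m≤m+n k (suc l))))) dₖ≡0)
  (l , (λ i i<l → ≡.trans (eq i i<l) (same i (ℕ.<⇒≤ i<l))) ,
   ≡.subst (α l Bool.<_) (same l ℕ.≤-refl) lt)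
  where
  same : ∀ i → i ℕ.≤ l → d (suc k ℕ.+ i) ≡ c (suc k ℕ.+ i)
  same i i≤l = agree (suc k ℕ.+ i) (ℕ.+-monoʳ-< (suc k) (s≤s i≤l))

-- Lexicographic infima

module LexInfimum (em : ExcludedMiddle 0ℓ) (P : Pred BinarySeq 0ℓ) where
  private
    pick : Pred BinarySeq 0ℓ → ℕ → Bool
    pick Q k with em {∃[ d ] d ∈ Q × d k ≡ false}
    ... | yes _ = false
    ... | no  _ = true

    -- These are the members of `P` that begin with the first k digits of the infimum; its next
    -- digit is 0 exactly when one of them has 0 there. If `P` is inhabited, every prefix of the
    -- infimum occurs in `P`, although the infimum itself may lie outside.
    Q : ℕ → Pred BinarySeq 0ℓ
    Q zero    d = d ∈ P
    Q (suc k) d = d ∈ Q k × d k ≡ pick (Q k) k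

  infimum : BinarySeq
  infimum k = pick (Q k) k

  private
    Q-inhabited : ∃ P → ∀ k → ∃ (Q k)
    Q-inhabited ne zero = ne
    Q-inhabited ne (suc k) with em {∃[ d ] d ∈ Q k × d k ≡ false} | Q-inhabited ne k
    ... | yes (d , d∈ , dₖ≡0) | _ = d , d∈ , dₖ≡0
    ... | no none | d , d∈ with bool-split (d k)
    ...   | inj₁ dₖ≡0 = contradiction (d , d∈ , dₖ≡0) none
    ...   | inj₂ dₖ≡1 = d , d∈ , dₖ≡1

    Q⇒ : ∀ k → d ∈ Q k → d ∈ P × Agree k infimum d
    Q⇒ zero    d∈ = d∈ , λ _ ()
    Q⇒ (suc k) (d∈ , eq) with Q⇒ k d∈
    ... | d∈P , agree = d∈P , λ i i<1+k → case (ℕ.m≤n⇒m<n∨m≡n (ℕ.≤-pred i<1+k)) agree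
      where
      case : ∀ {i} → i ℕ.< k ⊎ i ≡ k → Agree k infimum _ → infimum i ≡ _
      case (inj₁ i<k)    agree = agree _ i<k
      case (inj₂ ≡.refl) _     = ≡.sym eq

    ⇒Q : ∀ k → d ∈ P → Agree k infimum d → d ∈ Q k
    ⇒Q zero    d∈ _     = d∈
    ⇒Q (suc k) d∈ agree =
      ⇒Q k d∈ (Agree-≤ (ℕ.n≤1+n k) agree) , ≡.sym (agree k ℕ.≤-refl)

  approximation : ∃ P → ∀ k → ∃[ d ] d ∈ P × Agree k infimum d
  approximation ne k with Q-inhabited ne k
  ... | d , d∈ = d , Q⇒ k d∈

  -- A smaller `d` would lie in `Q k` and have 0 at the first difference k, but then `pick` would
  -- have chosen 0 there.
  lowerBound : d ∈ P → ¬ d <ₗₑₓ infimum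
  lowerBound {d} d∈ (k , eq , lt) with em {∃[ d ] d ∈ Q k × d k ≡ false}
  ... | yes _   = contradiction (<⇒true lt) λ ()
  ... | no none = none (d , ⇒Q k d∈ (λ i i<k → ≡.sym (eq i i<k)) , <⇒false lt)

-- Thue–Morse words

-- The substitution 0 ↦ 01, 1 ↦ 10.
Φ : BinarySeq → BinarySeq
Φ d zero          = d 0
Φ d (suc zero)    = not (d 0)
Φ d (suc (suc i)) = Φ (d ∘ suc) i

Φ-cong : c ≗ d → Φ c ≗ Φ d
Φ-cong eq zero          = eq 0
Φ-cong eq (suc zero)    = ≡.cong not (eq 0)
Φ-cong eq (suc (suc i)) = Φ-cong (eq ∘ suc) i

Φ-flip : ∀ d → Φ (flip d) ≗ flip (Φ d)
Φ-flip d zero          = ≡.refl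
Φ-flip d (suc zero)    = ≡.refl
Φ-flip d (suc (suc i)) = Φ-flip (d ∘ suc) i

Φ-shift : ∀ k d → shift (2 ℕ.* k) (Φ d) ≗ Φ (shift k d)
Φ-shift zero    d i = ≡.refl
Φ-shift (suc k) d i = ≡.trans
  (≡.cong (λ l → Φ d (l ℕ.+ i)) (ℕ.*-suc 2 k)) (Φ-shift k (d ∘ suc) i)

Φ-even : ∀ d k → Φ d (2 ℕ.* k) ≡ d k
Φ-even d zero    = ≡.refl
Φ-even d (suc k) = ≡.trans (≡.cong (Φ d) (ℕ.*-suc 2 k)) (Φ-even (d ∘ suc) k)

Φ-odd : ∀ d k → Φ d (suc (2 ℕ.* k)) ≡ not (d k)
Φ-odd d zero    = ≡.refl
Φ-odd d (suc k) = ≡.trans (≡.cong (Φ d ∘ suc) (ℕ.*-suc 2 k)) (Φ-odd (d ∘ suc) k)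

Φ-agree : ∀ k → Agree k c d → Agree (2 ℕ.* k) (Φ c) (Φ d)
Φ-agree zero    eq i ()
Φ-agree (suc k) eq rewrite ℕ.*-suc 2 k =
  Agree-∷ (eq 0 (s≤s z≤n))
    (Agree-∷ (≡.cong not (eq 0 (s≤s z≤n))) (Φ-agree k (Agree-tail eq)))

Φ-mono-< : c <ₗₑₓ d → Φ c <ₗₑₓ Φ d
Φ-mono-< {c} {d} (k , eq , lt) =
  2 ℕ.* k , Φ-agree k eq ,
  ≡.subst₂ Bool._<_ (≡.sym (Φ-even c k)) (≡.sym (Φ-even d k)) lt

even-or-odd : ∀ i → ∃[ k ] i ≡ 2 ℕ.* k ⊎ ∃[ k ] i ≡ suc (2 ℕ.* k)
even-or-odd zero          = inj₁ (0 , ≡.refl)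
even-or-odd (suc i) with even-or-odd i
... | inj₁ (k , eq) = inj₂ (k , ≡.cong suc eq)
... | inj₂ (k , eq) = inj₁ (suc k , ≡.trans (≡.cong suc eq) (≡.sym (ℕ.*-suc 2 k)))

-- (τ₀ ⋯ τ_{2ⁿ-1})^∞
periodic : ℕ → BinarySeq
periodic zero    _ = false
periodic (suc n) = Φ (periodic n)

periodic-zero : ∀ n → periodic n 0 ≡ false
periodic-zero zero    = ≡.refl
periodic-zero (suc n) = periodic-zero n

periodic-one : ∀ n → periodic (suc n) 1 ≡ true
periodic-one n = ≡.cong not (periodic-zero n)

periodic-agree : ∀ n → Agree (2 ℕ.^ n) (periodic n) (periodic (suc n))
periodic-agree zero zero    _ = ≡.refl
periodic-agree zero (suc i) (s≤s ())
periodic-agree (suc n) = Φ-agree (2 ℕ.^ n) (periodic-agree n)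

periodic-shift : ∀ n → shift (2 ℕ.^ n) (periodic n) ≗ periodic n
periodic-shift zero    i = ≡.refl
periodic-shift (suc n) i =
  ≡.trans (Φ-shift (2 ℕ.^ n) (periodic n) i) (Φ-cong (periodic-shift n) i)

-- For n = 0 the sequence is (01)^∞. The step works because `Φ` commutes with complementation and
-- doubles shifts.
periodic-flip : ∀ n → shift (2 ℕ.^ n) (periodic (suc n)) ≗ flip (periodic (suc n))
periodic-flip zero = base
  where
  base : shift 1 (periodic 1) ≗ flip (periodic 1)
  base zero          = ≡.refl
  base (suc zero)    = ≡.refl
  base (suc (suc i)) = base i
periodic-flip (suc n) i = ≡.trans (Φ-shift (2 ℕ.^ n) (periodic (suc n)) i)
  (≡.trans (Φ-cong (periodic-flip n) i) (Φ-flip (periodic (suc n)) i))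

periodic-τ : ∀ n i → i ℕ.< 2 ℕ.^ n → periodic n i ≡ τ i
periodic-τ zero    zero    _        = ≡.refl
periodic-τ zero    (suc i) (s≤s ())
periodic-τ (suc n) i       i< with ℕ.<-≤-connex i (2 ℕ.^ n)
... | inj₁ i<m = ≡.trans (≡.sym (periodic-agree n i i<m)) (periodic-τ n i i<m)
-- The second half of the period complements the first, which is the recursion satisfied by `τ`.
... | inj₂ m≤i = ≡.subst (λ l → periodic (suc n) l ≡ τ l) (ℕ.m+[n∸m]≡n m≤i) (begin
  periodic (suc n) (2 ℕ.^ n ℕ.+ j) ≡⟨ periodic-flip n j ⟩
  not (periodic (suc n) j)         ≡⟨ ≡.cong not (periodic-agree n j j<m) ⟨
  not (periodic n j)               ≡⟨ ≡.cong not (periodic-τ n j j<m) ⟩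
  not (τ j)                        ≡⟨ τ-2^m+j n j j<m ⟨
  τ (2 ℕ.^ n ℕ.+ j)                ∎)
  where
  open ≡.≡-Reasoning
  j = i ∸ 2 ℕ.^ n
  j<m : j ℕ.< 2 ℕ.^ n
  j<m = ≡.subst (j ℕ.<_) (ℕ.+-identityʳ (2 ℕ.^ n))
    (ℕ.m<n+o⇒m∸n<o i (2 ℕ.^ n) {{ℕ.>-nonZero (ℕ.≤-trans (ℕ.m^n>0 2 n) (ℕ.m≤m+n (2 ℕ.^ n) 0))}} i<)

-- A tail from the 0 of a block 01 = Φ(0) is Φ of a tail from a 0; a tail from the 0 of a block
-- 10 = Φ(1) begins with 00 or 010, whereas periodic (suc n) begins with 011.
periodic-tails : ExcludedMiddle 0ℓ → ∀ n i →
                 periodic n i ≡ false → ¬ periodic n <ₗₑₓ shift i (periodic n)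
periodic-tails em zero    i _ lt = <ₗₑₓ-irrefl (λ _ → ≡.refl) lt
periodic-tails em (suc n) i pᵢ≡0 lt with even-or-odd i
... | inj₁ (k , ≡.refl) with lex-compare em (shift k (periodic n)) (periodic n)
...   | inj₁ eq = <ₗₑₓ-irrefl
        (λ j → ≡.sym (≡.trans (Φ-shift k (periodic n) j) (Φ-cong eq j))) lt
...   | inj₂ (inj₁ lt′) = <ₗₑₓ-asym lt
        (<ₗₑₓ-resp (λ j → ≡.sym (Φ-shift k (periodic n) j)) (λ _ → ≡.refl) (Φ-mono-< lt′))
...   | inj₂ (inj₂ lt′) = contradiction lt′
        (periodic-tails em n k (≡.trans (≡.sym (Φ-even (periodic n) k)) pᵢ≡0))
periodic-tails em (suc zero) i pᵢ≡0 lt | inj₂ (k , ≡.refl) =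
  false≢true pᵢ≡0 (Φ-odd (periodic 0) k)
periodic-tails em (suc (suc n)) i pᵢ≡0 lt | inj₂ (k , ≡.refl) with bool-split (periodic (suc n) (suc k))
... | inj₁ pₖ₊₁≡0 = <ₗₑₓ-asym lt (1 , agree , f<t digit₁ (periodic-one (suc n)))
  where
  agree : Agree 1 (shift i (periodic (suc (suc n)))) (periodic (suc (suc n)))
  agree zero _ = ≡.trans (≡.trans (≡.cong (periodic (suc (suc n))) (ℕ.+-identityʳ i)) pᵢ≡0)
    (≡.sym (periodic-zero (suc (suc n))))
  agree (suc _) (s≤s ())
  digit₁ : periodic (suc (suc n)) (i ℕ.+ 1) ≡ false
  digit₁ = ≡.trans (≡.cong (periodic (suc (suc n))) (≡.trans (ℕ.+-comm i 1) (≡.sym (ℕ.*-suc 2 k))))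
    (≡.trans (Φ-even (periodic (suc n)) (suc k)) pₖ₊₁≡0)
... | inj₂ pₖ₊₁≡1 = <ₗₑₓ-asym lt (2 , agree , f<t digit₂ (periodic-one n))
  where
  agree : Agree 2 (shift i (periodic (suc (suc n)))) (periodic (suc (suc n)))
  agree zero _ = ≡.trans (≡.trans (≡.cong (periodic (suc (suc n))) (ℕ.+-identityʳ i)) pᵢ≡0)
    (≡.sym (periodic-zero (suc (suc n))))
  agree (suc zero) _ = ≡.trans
    (≡.trans (≡.cong (periodic (suc (suc n))) (≡.trans (ℕ.+-comm i 1) (≡.sym (ℕ.*-suc 2 k))))
      (≡.trans (Φ-even (periodic (suc n)) (suc k)) pₖ₊₁≡1))
    (≡.sym (periodic-one (suc n)))
  agree (suc (suc _)) (s≤s (s≤s ()))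
  digit₂ : periodic (suc (suc n)) (i ℕ.+ 2) ≡ false
  digit₂ = ≡.trans (≡.cong (periodic (suc (suc n)))
      (≡.trans (ℕ.+-comm i 2) (≡.cong suc (≡.sym (ℕ.*-suc 2 k)))))
    (≡.trans (Φ-odd (periodic (suc n)) (suc k)) (≡.cong not pₖ₊₁≡1))

-- (τ₁ ⋯ τ_{2ⁿ-1} 0)^∞, for n ≥ 1 the quasi-greedy expansion of 1 in base qₙ
quasi : ℕ → BinarySeq
quasi n i = periodic n (suc i)

quasi-shift : ∀ n → shift (2 ℕ.^ n) (quasi n) ≗ quasi n
quasi-shift n i = ≡.trans (≡.cong (periodic n) (≡.sym (ℕ.+-suc (2 ℕ.^ n) i))) (periodic-shift n (suc i))

-- `quasi n` is `periodic n` without its leading 0. Restoring that 0, together with the 0 in front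
-- of the tail, moves the comparison to `periodic n`, whose block structure is known.
quasi<tail : ∀ n {d} k → d k ≡ false → quasi n <ₗₑₓ shift (suc k) d → periodic n <ₗₑₓ shift k d
quasi<tail n {d} k dₖ≡0 lt = <ₗₑₓ-∷
  (≡.trans (periodic-zero n) (≡.sym (≡.trans (shift-zero k d) dₖ≡0)))
  (<ₗₑₓ-resp (λ _ → ≡.refl) (λ i → ≡.sym (shift-suc k d i)) lt)

tail<quasi : ∀ n {d} k → d k ≡ false → shift (suc k) d <ₗₑₓ quasi n → shift k d <ₗₑₓ periodic n
tail<quasi n {d} k dₖ≡0 lt = <ₗₑₓ-∷
  (≡.trans (≡.trans (shift-zero k d) dₖ≡0) (≡.sym (periodic-zero n)))
  (<ₗₑₓ-resp (λ i → ≡.sym (shift-suc k d i)) (λ _ → ≡.refl) lt)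

quasi-zeroTails : ExcludedMiddle 0ℓ → ∀ n → ZeroTails (quasi n) (quasi n)
quasi-zeroTails em n k aₖ≡0 lt = periodic-tails em n (suc k) aₖ≡0
  (quasi<tail n {periodic n} (suc k) aₖ≡0 lt)

StrictZeroTails : BinarySeq → Pred BinarySeq 0ℓ
StrictZeroTails α d = ∀ k → d k ≡ false → shift (suc k) d <ₗₑₓ α

-- With B = τ₀ ⋯ τ_{2ⁿ-1} and B̄ its complement, periodic n = B^∞ and periodic (suc n) = (B B̄)^∞.
-- A tail from a 0 that exceeds B^∞ and is less than (B B̄)^∞ starts with some copies of B
-- followed by B1.  The tail from that 1 is then both less and greater than (B̄ B)^∞.
module _ (n : ℕ) {d} (upper : StrictZeroTails (quasi (suc n)) d)
                     (lower : StrictZeroTails (quasi (suc n)) (flip d)) where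
  private
    M = 2 ℕ.^ n
    p = periodic n
    P = periodic (suc n)

    p-M : p M ≡ false
    p-M = ≡.trans (≡.sym (≡.cong p (ℕ.+-identityʳ M)))
      (≡.trans (periodic-shift n 0) (periodic-zero n))

    -- An excess inside the first block contradicts `upper`, since `p` and `P` agree there; an
    -- excess at place `M` is the essential case. Beyond that a block is dropped: the place reached
    -- again holds a 0, and as `M` is positive `l` shrinks, which `fuel` records.
    no-excess : ∀ fuel l k → l ℕ.≤ fuel → d k ≡ false → Agree l p (shift k d) →
                p l ≡ false → ¬ d (k ℕ.+ l) ≡ true
    no-excess fuel l k l≤ dₖ≡0 agree pₗ≡0 dₖ₊ₗ≡1 with ℕ.<-cmp l M
    no-excess fuel l k l≤ dₖ≡0 agree pₗ≡0 dₖ₊ₗ≡1 | tri< l<M _ _ =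
      <ₗₑₓ-asym (tail<quasi (suc n) {d} k dₖ≡0 (upper k dₖ≡0))
        (l , (λ i i<l → ≡.trans (≡.sym (periodic-agree n i (ℕ.<-trans i<l l<M))) (agree i i<l)) ,
         f<t (≡.trans (≡.sym (periodic-agree n l l<M)) pₗ≡0) dₖ₊ₗ≡1)
    no-excess fuel l k l≤ dₖ≡0 agree pₗ≡0 dₖ₊ₗ≡1 | tri≈ _ ≡.refl _ = <ₗₑₓ-asym below above
      where
      below : shift (k ℕ.+ M) d <ₗₑₓ flip P
      below = <ₗₑₓ-resp (λ i → ≡.cong d (≡.sym (ℕ.+-assoc k M i))) (periodic-flip n)
        (<ₗₑₓ-shift M (λ i i<M → ≡.trans (≡.sym (agree i i<M)) (periodic-agree n i i<M))
          (tail<quasi (suc n) {d} k dₖ≡0 (upper k dₖ≡0)))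
      above : flip P <ₗₑₓ shift (k ℕ.+ M) d
      above = <ₗₑₓ-resp (λ _ → ≡.refl) flip-flip
        (<ₗₑₓ-flip (tail<quasi (suc n) {flip d} (k ℕ.+ M) (≡.cong not dₖ₊ₗ≡1)
          (lower (k ℕ.+ M) (≡.cong not dₖ₊ₗ≡1))))
    no-excess zero    l k l≤ dₖ≡0 agree pₗ≡0 dₖ₊ₗ≡1 | tri> _ _ M<l =
      contradiction (ℕ.<-≤-trans M<l l≤) λ ()
    no-excess (suc fuel) l k l≤ dₖ≡0 agree pₗ≡0 dₖ₊ₗ≡1 | tri> _ _ M<l =
      no-excess fuel (l ∸ M) (k ℕ.+ M)
        (ℕ.≤-pred (ℕ.≤-trans (ℕ.∸-monoʳ-< {l} {M} {0} (ℕ.m^n>0 2 n) (ℕ.<⇒≤ M<l)) l≤))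
        (≡.trans (≡.sym (agree M M<l)) p-M)
        (λ i i< → ≡.trans (≡.sym (periodic-shift n i))
          (≡.trans (agree (M ℕ.+ i) (ℕ.<-≤-trans (ℕ.+-monoʳ-< M i<) (ℕ.≤-reflexive M+[l∸M])))
            (≡.cong d (≡.sym (ℕ.+-assoc k M i)))))
        (≡.trans (≡.sym (periodic-shift n (l ∸ M))) (≡.trans (≡.cong p M+[l∸M]) pₗ≡0))
        (≡.trans (≡.cong d (≡.trans (ℕ.+-assoc k M (l ∸ M)) (≡.cong (k ℕ.+_) M+[l∸M]))) dₖ₊ₗ≡1)
      where
      M+[l∸M] : M ℕ.+ (l ∸ M) ≡ l
      M+[l∸M] = ℕ.m+[n∸m]≡n (ℕ.<⇒≤ M<l)

  strict-zeroTails : ZeroTails (quasi n) d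
  strict-zeroTails k dₖ≡0 lt with quasi<tail n {d} k dₖ≡0 lt
  ... | l , agree , lt′ = no-excess l l k ℕ.≤-refl dₖ≡0 agree (<⇒false lt′) (<⇒true lt′)

strict⇒admissible : ∀ n {d} → StrictZeroTails (quasi (suc n)) d →
                    StrictZeroTails (quasi (suc n)) (flip d) → Admissible (quasi n) d
strict⇒admissible n upper lower =
  strict-zeroTails n upper lower ,
  strict-zeroTails n lower (λ k d≡0 → <ₗₑₓ-resp (λ _ → ≡.sym (not-involutive _)) (λ _ → ≡.refl)
    (upper k (≡.trans (≡.sym (not-involutive _)) d≡0)))

-- Shifting periodic (suc n) by half a period complements it.
flipped-quasi-tail : ∀ n {d} k → d k ≡ true → flip (shift (suc k) d) ≗ quasi (suc n) →
                     ∃[ l ] d l ≡ false × shift (suc l) d ≗ quasi (suc n)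
flipped-quasi-tail n {d} k dₖ≡1 eq =
  k ℕ.+ M ,
  (begin
    d (k ℕ.+ M)       ≡⟨ tail M ⟩
    not (P M)         ≡⟨ ≡.cong (not ∘ P) (ℕ.+-identityʳ M) ⟨
    not (P (M ℕ.+ 0)) ≡⟨ ≡.cong not (periodic-flip n 0) ⟩
    not (not (P 0))   ≡⟨ not-involutive _ ⟩
    P 0               ≡⟨ periodic-zero (suc n) ⟩
    false             ∎) ,
  λ i → begin
    d (suc (k ℕ.+ M ℕ.+ i)) ≡⟨ ≡.cong d (ℕ.+-suc (k ℕ.+ M) i) ⟨
    d (k ℕ.+ M ℕ.+ suc i)   ≡⟨ ≡.cong d (ℕ.+-assoc k M (suc i)) ⟩
    d (k ℕ.+ (M ℕ.+ suc i)) ≡⟨ tail (M ℕ.+ suc i) ⟩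
    not (P (M ℕ.+ suc i))   ≡⟨ ≡.cong not (periodic-flip n (suc i)) ⟩
    not (not (P (suc i)))   ≡⟨ not-involutive _ ⟩
    P (suc i)               ∎
  where
  open ≡.≡-Reasoning
  M = 2 ℕ.^ n
  P = periodic (suc n)
  tail : ∀ i → d (k ℕ.+ i) ≡ not (P i)
  tail zero    = ≡.trans (≡.cong d (ℕ.+-identityʳ k))
    (≡.trans dₖ≡1 (≡.cong not (≡.sym (periodic-zero (suc n)))))
  tail (suc i) = ≡.trans (≡.cong d (ℕ.+-suc k i))
    (≡.trans (≡.sym (not-involutive _)) (≡.cong not (eq i)))

-- Ordered fields

module RingSolver (R : CompleteOrderedField) where
  open CompleteOrderedField R
  open RingProperties ring
  open Multiplication semiring
    renaming (_×_ to _·_)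
  open SetoidReasoning setoid

  -- With coefficients in R itself the solver could not cancel 1# - 1#.
  private
    ⟦_⟧ : ℤ → Carrier
    ⟦ + n ⟧      = n · 1#
    ⟦ -[1+ n ] ⟧ = - (suc n · 1#)

    neg-homo : ∀ i → ⟦ ℤ.- i ⟧ ≈ - ⟦ i ⟧
    neg-homo (+ zero)  = sym -0#≈0#
    neg-homo (+ suc n) = refl
    neg-homo -[1+ n ]  = sym (-‿involutive _)

    ⊖-homo : ∀ m n → ⟦ m ⊖ n ⟧ ≈ m · 1# - n · 1#
    ⊖-homo m zero = begin
      ⟦ m ⊖ 0 ⟧     ≡⟨ ≡.cong ⟦_⟧ (ℤ.⊖-≥ {m} ℕ.z≤n) ⟩
      m · 1#        ≈⟨ +-identityʳ _ ⟨
      m · 1# + 0#   ≈⟨ +-congˡ -0#≈0# ⟨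
      m · 1# - 0#   ∎
    ⊖-homo zero    (suc n) = sym (+-identityˡ _)
    ⊖-homo (suc m) (suc n) = begin
      ⟦ suc m ⊖ suc n ⟧                ≡⟨ ≡.cong ⟦_⟧ (ℤ.[1+m]⊖[1+n]≡m⊖n m n) ⟩
      ⟦ m ⊖ n ⟧                        ≈⟨ ⊖-homo m n ⟩
      m · 1# - n · 1#                  ≈⟨ +-congˡ (+-identityˡ _) ⟨
      m · 1# + (0# - n · 1#)           ≈⟨ +-congˡ (+-congʳ (-‿inverseʳ 1#)) ⟨
      m · 1# + (1# - 1# - n · 1#)      ≈⟨ +-congˡ (+-assoc _ _ _) ⟩
      m · 1# + (1# + (- 1# - n · 1#))  ≈⟨ +-assoc _ _ _ ⟨
      m · 1# + 1# + (- 1# - n · 1#)    ≈⟨ +-cong (+-comm _ _) (-‿+-comm _ _) ⟩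
      1# + m · 1# - (1# + n · 1#)      ≈⟨ +-cong (1+× m 1#) (-‿cong (1+× n 1#)) ⟨
      suc m · 1# - suc n · 1#          ∎

    +-homo : ∀ i j → ⟦ i ℤ.+ j ⟧ ≈ ⟦ i ⟧ + ⟦ j ⟧
    +-homo (+ m)    (+ n)    = ×-homo-+ 1# m n
    +-homo (+ m)    -[1+ n ] = ⊖-homo m (suc n)
    +-homo -[1+ m ] (+ n)    = trans (⊖-homo n (suc m)) (+-comm _ _)
    +-homo -[1+ m ] -[1+ n ] = begin
      - (suc (suc (m ℕ.+ n)) · 1#)     ≡⟨ ≡.cong (λ k → - (suc k · 1#)) (≡.sym (ℕ.+-suc m n)) ⟩
      - ((suc m ℕ.+ suc n) · 1#)       ≈⟨ -‿cong (×-homo-+ 1# (suc m) (suc n)) ⟩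
      - (suc m · 1# + suc n · 1#)      ≈⟨ -‿+-comm _ _ ⟨
      - (suc m · 1#) - suc n · 1#      ∎

    *-homo⁺ : ∀ m j → ⟦ + m ℤ.* j ⟧ ≈ m · 1# * ⟦ j ⟧
    *-homo⁺ m (+ n)    = trans (reflexive (≡.cong ⟦_⟧ (≡.sym (ℤ.pos-* m n)))) (×1-homo-* m n)
    *-homo⁺ m -[1+ n ] = begin
      ⟦ + m ℤ.* -[1+ n ] ⟧      ≡⟨ ≡.cong ⟦_⟧ (≡.sym (ℤ.neg-distribʳ-* (+ m) (+ suc n))) ⟩
      ⟦ ℤ.- (+ m ℤ.* + suc n) ⟧ ≈⟨ neg-homo (+ m ℤ.* + suc n) ⟩
      - ⟦ + m ℤ.* + suc n ⟧     ≈⟨ -‿cong (*-homo⁺ m (+ suc n)) ⟩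
      - (m · 1# * suc n · 1#)   ≈⟨ -‿distribʳ-* _ _ ⟩
      m · 1# * - (suc n · 1#)   ∎

    *-homo : ∀ i j → ⟦ i ℤ.* j ⟧ ≈ ⟦ i ⟧ * ⟦ j ⟧
    *-homo (+ m)    j = *-homo⁺ m j
    *-homo -[1+ m ] j = begin
      ⟦ -[1+ m ] ℤ.* j ⟧      ≡⟨ ≡.cong ⟦_⟧ (≡.sym (ℤ.neg-distribˡ-* (+ suc m) j)) ⟩
      ⟦ ℤ.- (+ suc m ℤ.* j) ⟧ ≈⟨ neg-homo (+ suc m ℤ.* j) ⟩
      - ⟦ + suc m ℤ.* j ⟧     ≈⟨ -‿cong (*-homo⁺ (suc m) j) ⟩
      - (suc m · 1# * ⟦ j ⟧)  ≈⟨ -‿distribˡ-* _ _ ⟩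
      - (suc m · 1#) * ⟦ j ⟧  ∎

    morphism : ℤ.+-*-rawRing -Raw-AlmostCommutative⟶ fromCommutativeRing commutativeRing
    morphism = record
      { ⟦_⟧    = ⟦_⟧
      ; +-homo = +-homo
      ; *-homo = *-homo
      ; -‿homo = neg-homo
      ; 0-homo = refl
      ; 1-homo = refl
      }

    coeff≟ : ∀ i j → Maybe (⟦ i ⟧ ≈ ⟦ j ⟧)
    coeff≟ i j with i ℤ.≟ j
    ... | yes ≡.refl = just refl
    ... | no  _      = nothing

  open Algebra.Solver.Ring ℤ.+-*-rawRing (fromCommutativeRing commutativeRing) morphism coeff≟ public
    using (Polynomial; solve; con; _:+_; _:*_; _:-_; :-_; _:=_)

  :0 :1 : ∀ {n} → Polynomial n
  :0 = con (+ 0)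
  :1 = con (+ 1)

module OrderedField (R : CompleteOrderedField) where
  open CompleteOrderedField R public
  open RingSolver R public
  open IsStrictTotalOrder isStrictTotalOrder public
    using (compare; <-resp-≈; <-respˡ-≈; <-respʳ-≈; asym; irrefl; isStrictPartialOrder)
    renaming (trans to <-trans)

  private
    module NS = StrictToNonStrict _≈_ _<_

  strictPartialOrder : StrictPartialOrder _ _ _
  strictPartialOrder = record { isStrictPartialOrder = isStrictPartialOrder }

  module Reasoning = StrictReasoning strictPartialOrder
  open Reasoning

  private variable
    u v w x y z : Carrier

  ≤-refl : x ≤ x
  ≤-refl = inj₂ refl

  <⇒≤ : x < y → x ≤ y
  <⇒≤ = inj₁

  ≈⇒≤ : x ≈ y → x ≤ y
  ≈⇒≤ = inj₂

  ≤-trans : x ≤ y → y ≤ z → x ≤ z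
  ≤-trans = NS.trans isEquivalence <-resp-≈ <-trans

  <-≤-trans : x < y → y ≤ z → x < z
  <-≤-trans = NS.<-≤-trans <-trans <-respʳ-≈

  ≤-<-trans : x ≤ y → y < z → x < z
  ≤-<-trans = NS.≤-<-trans sym <-trans <-respˡ-≈

  ≤-antisym : x ≤ y → y ≤ x → x ≈ y
  ≤-antisym = NS.antisym isEquivalence <-trans irrefl

  ≤-or-> : ∀ x y → x ≤ y ⊎ y < x
  ≤-or-> x y with compare x y
  ... | tri< x<y _ _ = inj₁ (inj₁ x<y)
  ... | tri≈ _ x≈y _ = inj₁ (inj₂ x≈y)
  ... | tri> _ _ y<x = inj₂ y<x

  ≤⇒≯ : x ≤ y → ¬ y < x
  ≤⇒≯ (inj₁ x<y) y<x = asym x<y y<x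
  ≤⇒≯ (inj₂ x≈y) y<x = irrefl (sym x≈y) y<x

  ≮⇒≥ : ¬ x < y → y ≤ x
  ≮⇒≥ {x} {y} x≮y with ≤-or-> y x
  ... | inj₁ y≤x = y≤x
  ... | inj₂ x<y = contradiction x<y x≮y

  ≰⇒> : ¬ x ≤ y → y < x
  ≰⇒> {x} {y} x≰y with ≤-or-> x y
  ... | inj₁ x≤y = contradiction x≤y x≰y
  ... | inj₂ y<x = y<x

  +-monoʳ-< : ∀ z → x < y → z + x < z + y
  +-monoʳ-< z x<y = <-respˡ-≈ (+-comm _ z) (<-respʳ-≈ (+-comm _ z) (+-monoˡ-< z x<y))

  +-monoˡ-≤ : ∀ z → x ≤ y → x + z ≤ y + z
  +-monoˡ-≤ z (inj₁ x<y) = inj₁ (+-monoˡ-< z x<y)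
  +-monoˡ-≤ z (inj₂ x≈y) = inj₂ (+-congʳ x≈y)

  +-monoʳ-≤ : ∀ z → x ≤ y → z + x ≤ z + y
  +-monoʳ-≤ z (inj₁ x<y) = inj₁ (+-monoʳ-< z x<y)
  +-monoʳ-≤ z (inj₂ x≈y) = inj₂ (+-congˡ x≈y)

  +-mono-≤ : x ≤ y → u ≤ v → x + u ≤ y + v
  +-mono-≤ x≤y u≤v = ≤-trans (+-monoˡ-≤ _ x≤y) (+-monoʳ-≤ _ u≤v)

  +-cancelʳ-≤ : ∀ z → x + z ≤ y + z → x ≤ y
  +-cancelʳ-≤ z le = ≮⇒≥ λ y<x → ≤⇒≯ le (+-monoˡ-< z y<x)

  +-cancelʳ-< : ∀ z → x + z < y + z → x < y
  +-cancelʳ-< z lt = ≰⇒> λ y≤x → ≤⇒≯ (+-monoˡ-≤ z y≤x) lt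

  x≤y⇒0≤y-x : x ≤ y → 0# ≤ y - x
  x≤y⇒0≤y-x {x} le = ≤-trans (≈⇒≤ (sym (-‿inverseʳ x))) (+-monoˡ-≤ (- x) le)

  x<y⇒0<y-x : x < y → 0# < y - x
  x<y⇒0<y-x {x} lt = <-respˡ-≈ (-‿inverseʳ x) (+-monoˡ-< (- x) lt)

  ≤-by : 0# ≤ z → x + z ≈ y → x ≤ y
  ≤-by {z} {x} 0≤z eq = ≤-trans (≈⇒≤ (sym (+-identityʳ x))) (≤-trans (+-monoʳ-≤ x 0≤z) (≈⇒≤ eq))

  <-by : 0# < z → x + z ≈ y → x < y
  <-by {z} {x} 0<z eq = <-respˡ-≈ (+-identityʳ x) (<-respʳ-≈ eq (+-monoʳ-< x 0<z))

  +-nonneg : 0# ≤ x → 0# ≤ y → 0# ≤ x + y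
  +-nonneg 0≤x 0≤y = ≤-trans (≈⇒≤ (sym (+-identityʳ 0#))) (+-mono-≤ 0≤x 0≤y)

  *-nonneg : 0# ≤ x → 0# ≤ y → 0# ≤ x * y
  *-nonneg         (inj₁ 0<x) (inj₁ 0<y) = inj₁ (*-pos 0<x 0<y)
  *-nonneg {x}     _          (inj₂ 0≈y) = inj₂ (trans (sym (zeroʳ x)) (*-congˡ 0≈y))
  *-nonneg {_} {y} (inj₂ 0≈x) _          = inj₂ (trans (sym (zeroˡ y)) (*-congʳ 0≈x))

  *-monoʳ-≤ : 0# ≤ z → x ≤ y → z * x ≤ z * y
  *-monoʳ-≤ {z} {x} {y} 0≤z x≤y = ≤-by (*-nonneg 0≤z (x≤y⇒0≤y-x x≤y))
    (solve 3 (λ z x y → z :* x :+ z :* (y :- x) := z :* y) refl z x y)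

  *-monoˡ-≤ : 0# ≤ z → x ≤ y → x * z ≤ y * z
  *-monoˡ-≤ 0≤z x≤y = ≤-trans (≈⇒≤ (*-comm _ _)) (≤-trans (*-monoʳ-≤ 0≤z x≤y) (≈⇒≤ (*-comm _ _)))

  *-monoʳ-< : 0# < z → x < y → z * x < z * y
  *-monoʳ-< {z} {x} {y} 0<z x<y = <-by (*-pos 0<z (x<y⇒0<y-x x<y))
    (solve 3 (λ z x y → z :* x :+ z :* (y :- x) := z :* y) refl z x y)

  *-monoˡ-< : 0# < z → x < y → x * z < y * z
  *-monoˡ-< 0<z x<y = <-respˡ-≈ (*-comm _ _) (<-respʳ-≈ (*-comm _ _) (*-monoʳ-< 0<z x<y))

  *-cancelˡ-≤ : 0# < z → z * x ≤ z * y → x ≤ y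
  *-cancelˡ-≤ 0<z le = ≮⇒≥ λ y<x → ≤⇒≯ le (*-monoʳ-< 0<z y<x)

  *-cancelˡ-< : 0# < z → z * x < z * y → x < y
  *-cancelˡ-< 0<z lt = ≰⇒> λ y≤x → ≤⇒≯ (*-monoʳ-≤ (<⇒≤ 0<z) y≤x) lt

  ⁻¹-inverseʳ : 0# < x → x * x ⁻¹ ≈ 1#
  ⁻¹-inverseʳ {x} 0<x = trans (*-comm _ _) (⁻¹-inverseˡ x λ x≈0 → irrefl (sym x≈0) 0<x)

  ⁻¹-pos : 0# < x → 0# < x ⁻¹
  ⁻¹-pos {x} 0<x = *-cancelˡ-< 0<x
    (<-respˡ-≈ (sym (zeroʳ x)) (<-respʳ-≈ (sym (⁻¹-inverseʳ 0<x)) 0<1))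

  ⁻¹-unique : 0# < x → x * y ≈ 1# → x ⁻¹ ≈ y
  ⁻¹-unique {x} {y} 0<x xy≈1 = begin-equality
    x ⁻¹           ≈⟨ *-identityʳ _ ⟨
    x ⁻¹ * 1#      ≈⟨ *-congˡ xy≈1 ⟨
    x ⁻¹ * (x * y) ≈⟨ solve 3 (λ i x y → i :* (x :* y) := x :* i :* y) refl (x ⁻¹) x y ⟩
    x * x ⁻¹ * y   ≈⟨ *-congʳ (⁻¹-inverseʳ 0<x) ⟩
    1# * y         ≈⟨ *-identityˡ y ⟩
    y              ∎

  min-pos : 0# < x → 0# < y → ∃[ z ] 0# < z × z ≤ x × z ≤ y
  min-pos {x} {y} 0<x 0<y with ≤-or-> x y
  ... | inj₁ x≤y = x , 0<x , ≤-refl , x≤y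
  ... | inj₂ y<x = y , 0<y , <⇒≤ y<x , ≤-refl

  dense : x < y → ∃[ z ] x < z × z < y
  dense {x} {y} x<y = mean ,
    *-cancelˡ-< 0<2 (<-by (x<y⇒0<y-x x<y) eq₁) ,
    *-cancelˡ-< 0<2 (<-by (x<y⇒0<y-x x<y) eq₂)
    where
    2′ = 1# + 1#
    0<2 : 0# < 2′
    0<2 = <-trans 0<1 (<-by 0<1 refl)
    mean = (x + y) * 2′ ⁻¹
    2mean : 2′ * mean ≈ x + y
    2mean = trans (solve 3 (λ t s i → t :* (s :* i) := t :* i :* s) refl 2′ (x + y) (2′ ⁻¹))
      (trans (*-congʳ (⁻¹-inverseʳ 0<2)) (*-identityˡ _))
    eq₁ : 2′ * x + (y - x) ≈ 2′ * mean
    eq₁ = trans (solve 2 (λ x y → (:1 :+ :1) :* x :+ (y :- x) := x :+ y) refl x y) (sym 2mean)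
    eq₂ : 2′ * mean + (y - x) ≈ 2′ * y
    eq₂ = trans (+-congʳ 2mean) (solve 2 (λ x y → x :+ y :+ (y :- x) := (:1 :+ :1) :* y) refl x y)

-- Partial sums of expansions

module PartialSums (R : CompleteOrderedField) where
  open OrderedField R
  open Expansions R using (digit; partialSum)
  open Exponentiation semiring public using (_^_; ^-homo-*)
  private module Sums = Summation semiring
  open Reasoning

  private variable
    r r′ q u x : Carrier
    N : ℕ

  -- d₁ r + ⋯ + d_N r^N; in the applications r = q⁻¹
  S : Carrier → BinarySeq → ℕ → Carrier
  S r d zero    = 0#
  S r d (suc N) = r * (digit (d 0) + S r (d ∘ suc) N)

  0≤digit : ∀ b → 0# ≤ digit b
  0≤digit true  = <⇒≤ 0<1
  0≤digit false = ≤-refl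

  digit≤1 : ∀ b → digit b ≤ 1#
  digit≤1 true  = ≤-refl
  digit≤1 false = <⇒≤ 0<1

  ^-pos : 0# < r → ∀ n → 0# < r ^ n
  ^-pos 0<r zero    = 0<1
  ^-pos 0<r (suc n) = *-pos 0<r (^-pos 0<r n)

  private
    ^-⁻¹ : 0# < q → ∀ n → (q ^ n) ⁻¹ ≈ (q ⁻¹) ^ n
    ^-⁻¹ {q} 0<q n = ⁻¹-unique (^-pos 0<q n) (inverse n)
      where
      inverse : ∀ n → q ^ n * (q ⁻¹) ^ n ≈ 1#
      inverse zero    = *-identityˡ 1#
      inverse (suc n) = begin-equality
        q * q ^ n * (q ⁻¹ * (q ⁻¹) ^ n)
          ≈⟨ solve 4 (λ a b c d → a :* b :* (c :* d) := a :* c :* (b :* d))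
               refl q (q ^ n) (q ⁻¹) ((q ⁻¹) ^ n) ⟩
        q * q ⁻¹ * (q ^ n * (q ⁻¹) ^ n)
          ≈⟨ *-cong (⁻¹-inverseʳ 0<q) (inverse n) ⟩
        1# * 1#
          ≈⟨ *-identityˡ 1# ⟩
        1# ∎

    sum≈S : ∀ r d N → Sums.sum {N} (λ i → digit (d (toℕ i)) * r ^ suc (toℕ i)) ≈ S r d N
    sum≈S r d zero    = refl
    sum≈S r d (suc N) = begin-equality
      digit (d 0) * (r * 1#) + Sums.sum {N} (λ i → digit (d (suc (toℕ i))) * (r * r ^ suc (toℕ i)))
        ≈⟨ +-congˡ (Sums.sum-cong-≋ {N} λ i → solve 3 (λ a r p → a :* (r :* p) := r :* (a :* p)) refl
             (digit (d (suc (toℕ i)))) r (r ^ suc (toℕ i))) ⟩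
      digit (d 0) * (r * 1#) + Sums.sum {N} (λ i → r * (digit (d (suc (toℕ i))) * r ^ suc (toℕ i)))
        ≈⟨ +-congˡ (Sums.*-distribˡ-sum {N} r _) ⟨
      digit (d 0) * (r * 1#) + r * Sums.sum {N} (λ i → digit (d (suc (toℕ i))) * r ^ suc (toℕ i))
        ≈⟨ +-congˡ (*-congˡ (sum≈S r (d ∘ suc) N)) ⟩
      digit (d 0) * (r * 1#) + r * S r (d ∘ suc) N
        ≈⟨ solve 3 (λ a r s → a :* (r :* :1) :+ r :* s := r :* (a :+ s))
             refl (digit (d 0)) r (S r (d ∘ suc) N) ⟩
      r * (digit (d 0) + S r (d ∘ suc) N) ∎

  partialSum≈S : 0# < q → ∀ d N → partialSum d q N ≈ S (q ⁻¹) d N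
  partialSum≈S {q} 0<q d N = trans
    (Sums.sum-cong-≋ {N} λ i → *-congˡ (^-⁻¹ 0<q (suc (toℕ i))))
    (sum≈S (q ⁻¹) d N)

  S-congˡ : r ≈ r′ → ∀ d N → S r d N ≈ S r′ d N
  S-congˡ r≈r′ d zero    = refl
  S-congˡ r≈r′ d (suc N) = *-cong r≈r′ (+-congˡ (S-congˡ r≈r′ (d ∘ suc) N))

  S-agree : ∀ r N → Agree N c d → S r c N ≡ S r d N
  S-agree r zero    eq = ≡.refl
  S-agree r (suc N) eq = ≡.cong₂ (λ b s → r * (digit b + s)) (eq 0 (s≤s z≤n))
    (S-agree r N (Agree-tail eq))

  S-cong : ∀ r → c ≗ d → ∀ N → S r c N ≡ S r d N
  S-cong r eq N = S-agree r N λ i _ → eq i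

  S-split : ∀ r d k N → S r d (k ℕ.+ N) ≈ S r d k + r ^ k * S r (shift k d) N
  S-split r d zero    N = sym (trans (+-identityˡ _) (*-identityˡ _))
  S-split r d (suc k) N = begin-equality
    r * (digit (d 0) + S r (d ∘ suc) (k ℕ.+ N))
      ≈⟨ *-congˡ (+-congˡ (S-split r (d ∘ suc) k N)) ⟩
    r * (digit (d 0) + (S r (d ∘ suc) k + r ^ k * S r (shift (suc k) d) N))
      ≈⟨ solve 5 (λ r a s p t → r :* (a :+ (s :+ p :* t)) := r :* (a :+ s) :+ r :* p :* t) refl
           r (digit (d 0)) (S r (d ∘ suc) k) (r ^ k) (S r (shift (suc k) d) N) ⟩
    r * (digit (d 0) + S r (d ∘ suc) k) + r * r ^ k * S r (shift (suc k) d) N ∎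

  S-suc : ∀ r d k → S r d (suc k) ≈ S r d k + r ^ k * (r * digit (d k))
  S-suc r d k = begin-equality
    S r d (suc k)                                     ≡⟨ ≡.cong (S r d) (ℕ.+-comm 1 k) ⟩
    S r d (k ℕ.+ 1)                                   ≈⟨ S-split r d k 1 ⟩
    S r d k + r ^ k * (r * (digit (d (k ℕ.+ 0)) + 0#))
      ≡⟨ ≡.cong (λ l → S r d k + r ^ k * (r * (digit (d l) + 0#))) (ℕ.+-identityʳ k) ⟩
    S r d k + r ^ k * (r * (digit (d k) + 0#))
      ≈⟨ +-congˡ (*-congˡ (*-congˡ (+-identityʳ _))) ⟩
    S r d k + r ^ k * (r * digit (d k))               ∎

  S-nonneg : 0# < r → ∀ d N → 0# ≤ S r d N
  S-nonneg 0<r d zero    = ≤-refl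
  S-nonneg 0<r d (suc N) = *-nonneg (<⇒≤ 0<r) (+-nonneg (0≤digit (d 0)) (S-nonneg 0<r (d ∘ suc) N))

  S-monoʳ : 0# < r → ∀ d → m ℕ.≤ n → S r d m ≤ S r d n
  S-monoʳ {r} {m} {n} 0<r d m≤n = ≤-by
    (*-nonneg (<⇒≤ (^-pos 0<r m)) (S-nonneg 0<r (shift m d) (n ∸ m)))
    (trans (sym (S-split r d m (n ∸ m))) (reflexive (≡.cong (S r d) (ℕ.m+[n∸m]≡n m≤n))))

  S-monoˡ : 0# < r → r ≤ r′ → ∀ d N → S r d N ≤ S r′ d N
  S-monoˡ 0<r r≤r′ d zero    = ≤-refl
  S-monoˡ {r} {r′} 0<r r≤r′ d (suc N) = ≤-trans
    (*-monoˡ-≤ (+-nonneg (0≤digit (d 0)) (S-nonneg 0<r (d ∘ suc) N)) r≤r′)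
    (*-monoʳ-≤ (≤-trans (<⇒≤ 0<r) r≤r′) (+-monoʳ-≤ _ (S-monoˡ 0<r r≤r′ (d ∘ suc) N)))

  -- rⁱ / r ≤ r′ⁱ / r′ term by term.
  S-scale : 0# < r → r ≤ r′ → ∀ d N → r′ * S r d N ≤ r * S r′ d N
  S-scale {r} {r′} 0<r r≤r′ d zero    = ≈⇒≤ (trans (zeroʳ r′) (sym (zeroʳ r)))
  S-scale {r} {r′} 0<r r≤r′ d (suc N) = begin
    r′ * (r * (digit (d 0) + S r (d ∘ suc) N))  ≈⟨ swap ⟩
    r * (r′ * (digit (d 0) + S r (d ∘ suc) N))
      ≤⟨ *-monoʳ-≤ (<⇒≤ 0<r) (*-monoʳ-≤ (≤-trans (<⇒≤ 0<r) r≤r′)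
           (+-monoʳ-≤ _ (S-monoˡ 0<r r≤r′ (d ∘ suc) N))) ⟩
    r * (r′ * (digit (d 0) + S r′ (d ∘ suc) N)) ∎
    where
    swap : r′ * (r * (digit (d 0) + S r (d ∘ suc) N)) ≈ r * (r′ * (digit (d 0) + S r (d ∘ suc) N))
    swap = solve 3 (λ a b c → a :* (b :* c) := b :* (a :* c)) refl r′ r _

  -- Compare d with a digit by digit.  Where d first has 0 against a 1 of a, the remaining tail
  -- follows a 0, so by induction it contributes at most as much as that digit 1 of a.
  S-ZeroTails : ∀ {a} → 0# < r → (∀ N → S r a N ≤ 1#) →
                ZeroTails a d → ¬ a <ₗₑₓ d → ∀ N → S r d N ≤ 1#
  S-ZeroTails {r} {d} {a} 0<r Sa≤1 tails a≮d N =
    ≤-trans (≈⇒≤ (sym (trans (+-identityˡ _) (*-identityˡ _)))) (bound N 0 d tails a≮d)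
    where
    -- Here `j` counts the digits of `a` already matched and `d` is what remains. Meeting a 0
    -- against a 1 of `a` restarts the comparison at j = 0.
    bound : ∀ N j d → ZeroTails a d → ¬ shift j a <ₗₑₓ d → S r a j + r ^ j * S r d N ≤ 1#
    bound zero    j d tails j≮ = ≤-trans (≈⇒≤ (trans (+-congˡ (zeroʳ _)) (+-identityʳ _))) (Sa≤1 j)
    bound (suc N) j d tails j≮ with d 0 Bool.≟ a j
    ... | yes d₀≡aⱼ = begin
      S r a j + r ^ j * (r * (digit (d 0) + S r (d ∘ suc) N))
        ≡⟨ ≡.cong (λ b → S r a j + r ^ j * (r * (digit b + S r (d ∘ suc) N))) d₀≡aⱼ ⟩
      S r a j + r ^ j * (r * (digit (a j) + S r (d ∘ suc) N))
        ≈⟨ solve 5 (λ s p r b t → s :+ p :* (r :* (b :+ t)) := s :+ p :* (r :* b) :+ r :* p :* t)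
             refl (S r a j) (r ^ j) r (digit (a j)) (S r (d ∘ suc) N) ⟩
      S r a j + r ^ j * (r * digit (a j)) + r ^ suc j * S r (d ∘ suc) N
        ≈⟨ +-congʳ (S-suc r a j) ⟨
      S r a (suc j) + r ^ suc j * S r (d ∘ suc) N
        ≤⟨ bound N (suc j) (d ∘ suc) (λ k → tails (suc k)) (λ lt → j≮ (<ₗₑₓ-∷
             (≡.trans (shift-zero j a) (≡.sym d₀≡aⱼ))
             (<ₗₑₓ-resp (λ i → ≡.sym (shift-suc j a i)) (λ _ → ≡.refl) lt))) ⟩
      1# ∎
    ... | no d₀≢aⱼ with bool-split (d 0) | bool-split (a j)
    ...   | inj₁ d₀≡0 | inj₁ aⱼ≡0 = contradiction (≡.trans d₀≡0 (≡.sym aⱼ≡0)) d₀≢aⱼ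
    ...   | inj₂ d₀≡1 | inj₂ aⱼ≡1 = contradiction (≡.trans d₀≡1 (≡.sym aⱼ≡1)) d₀≢aⱼ
    ...   | inj₂ d₀≡1 | inj₁ aⱼ≡0 =
      contradiction (0 , (λ _ ()) , f<t (≡.trans (shift-zero j a) aⱼ≡0) d₀≡1) j≮
    ...   | inj₁ d₀≡0 | inj₂ aⱼ≡1 = begin
      S r a j + r ^ j * (r * (digit (d 0) + S r (d ∘ suc) N))
        ≡⟨ ≡.cong (λ b → S r a j + r ^ j * (r * (digit b + S r (d ∘ suc) N))) d₀≡0 ⟩
      S r a j + r ^ j * (r * (0# + S r (d ∘ suc) N))
        ≈⟨ solve 4 (λ s p r t → s :+ p :* (r :* (:0 :+ t)) := s :+ p :* (r :* (:0 :+ :1 :* t)))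
             refl (S r a j) (r ^ j) r (S r (d ∘ suc) N) ⟩
      S r a j + r ^ j * (r * (0# + 1# * S r (d ∘ suc) N))
        ≤⟨ +-monoʳ-≤ _ (*-monoʳ-≤ (<⇒≤ (^-pos 0<r j)) (*-monoʳ-≤ (<⇒≤ 0<r)
             (bound N 0 (d ∘ suc) (λ k → tails (suc k)) (tails 0 d₀≡0)))) ⟩
      S r a j + r ^ j * (r * 1#)
        ≡⟨ ≡.cong (λ b → S r a j + r ^ j * (r * digit b)) aⱼ≡1 ⟨
      S r a j + r ^ j * (r * digit (a j))
        ≈⟨ S-suc r a j ⟨
      S r a (suc j)
        ≤⟨ Sa≤1 (suc j) ⟩
      1# ∎

-- Values of expansions

module LimitTheory (em : ExcludedMiddle 0ℓ) (R : CompleteOrderedField) where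
  open OrderedField R
  open PartialSums R
  open Expansions R using (digit; partialSum; HasValue; _<⁺_)
  open Reasoning

  private variable
    r p x u v w : Carrier

  -- The terms are nonnegative for r > 0, so partial sums increase and their limit is their least
  -- upper bound.
  IsLimit : Carrier → BinarySeq → Pred Carrier 0ℓ
  IsLimit r d v = (∀ N → S r d N ≤ v) × (∀ u → (∀ N → S r d N ≤ u) → v ≤ u)

  IsLimit-resp : v ≈ w → IsLimit r d v → IsLimit r d w
  IsLimit-resp v≈w (above , least) =
    (λ N → ≤-trans (above N) (≈⇒≤ v≈w)) , λ u h → ≤-trans (≈⇒≤ (sym v≈w)) (least u h)

  IsLimit-unique : IsLimit r d v → IsLimit r d w → v ≈ w
  IsLimit-unique (above₁ , least₁) (above₂ , least₂) = ≤-antisym (least₁ _ above₂) (least₂ _ above₁)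

  IsLimit-base : ∀ {r r′} → r ≈ r′ → IsLimit r d v → IsLimit r′ d v
  IsLimit-base {d} {r = r} {r′} r≈r′ (above , least) =
    (λ N → ≤-trans (≈⇒≤ (sym (S-congˡ r≈r′ d N))) (above N)) ,
    λ u h → least u λ N → ≤-trans (≈⇒≤ (S-congˡ r≈r′ d N)) (h N)

  below-limit : IsLimit r d v → u < v → ∃[ N ] u < S r d N
  below-limit {r} {d} {v} {u} (_ , least) u<v with em {∃[ N ] u < S r d N}
  ... | yes found = found
  ... | no  none  = contradiction u<v (≤⇒≯ (least u λ N → ≮⇒≥ λ lt → none (N , lt)))

  bounded⇒limit : (∀ N → S r d N ≤ u) → ∃ (IsLimit r d)
  bounded⇒limit {r} {d} {u} bounded
    with complete (λ y → ∃[ N ] y ≈ S r d N) (0# , 0 , refl)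
           (u , λ (N , eq) → ≤-trans (≈⇒≤ eq) (bounded N))
  ... | s , above , least = s , (λ N → above (N , refl)) ,
        λ w h → least λ (N , eq) → ≤-trans (≈⇒≤ eq) (h N)

  HasValue⇒IsLimit : 0# < p → HasValue d p [ v ] → IsLimit (p ⁻¹) d v
  HasValue⇒IsLimit {p} {d} {v} 0<p conv = above , least
    where
    above : ∀ N → S (p ⁻¹) d N ≤ v
    -- Once a partial sum exceeds `v`, all later ones do so by at least as much; this excess is the
    -- ε to use.
    above N = ≮⇒≥ λ v<S → let (M , near) = conv (S (p ⁻¹) d N - v) (x<y⇒0<y-x v<S) in
      irrefl refl (begin-strict
        partialSum d p (M ℕ.⊔ N)  <⟨ proj₂ (near (M ℕ.⊔ N) (ℕ.m≤m⊔n M N)) ⟩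
        v + (S (p ⁻¹) d N - v)    ≈⟨ solve 2 (λ v s → v :+ (s :- v) := s) refl v (S (p ⁻¹) d N) ⟩
        S (p ⁻¹) d N              ≤⟨ S-monoʳ (⁻¹-pos 0<p) d (ℕ.m≤n⊔m M N) ⟩
        S (p ⁻¹) d (M ℕ.⊔ N)      ≈⟨ partialSum≈S 0<p d (M ℕ.⊔ N) ⟨
        partialSum d p (M ℕ.⊔ N)  ∎)
    least : ∀ u → (∀ N → S (p ⁻¹) d N ≤ u) → v ≤ u
    least u bounded = ≮⇒≥ λ u<v → let (M , near) = conv (v - u) (x<y⇒0<y-x u<v) in
      irrefl refl (begin-strict
        u                 ≈⟨ solve 2 (λ v u → v :- (v :- u) := u) refl v u ⟨
        v - (v - u)       <⟨ proj₁ (near M ℕ.≤-refl) ⟩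
        partialSum d p M  ≈⟨ partialSum≈S 0<p d M ⟩
        S (p ⁻¹) d M      ≤⟨ bounded M ⟩
        u                 ∎)

  IsLimit⇒HasValue : 0# < p → IsLimit (p ⁻¹) d v → HasValue d p [ v ]
  IsLimit⇒HasValue {p} {d} {v} 0<p lim ε 0<ε
    with below-limit lim (<-by 0<ε (solve 2 (λ v e → v :- e :+ e := v) refl v ε))
  ... | N , v-ε<S = N , λ m N≤m →
        (begin-strict
          v - ε             <⟨ v-ε<S ⟩
          S (p ⁻¹) d N      ≤⟨ S-monoʳ (⁻¹-pos 0<p) d N≤m ⟩
          S (p ⁻¹) d m      ≈⟨ partialSum≈S 0<p d m ⟨
          partialSum d p m  ∎) ,
        (begin-strict
          partialSum d p m  ≈⟨ partialSum≈S 0<p d m ⟩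
          S (p ⁻¹) d m      ≤⟨ proj₁ lim m ⟩
          v                 <⟨ <-by 0<ε refl ⟩
          v + ε             ∎)

  -- A value exceeds x as soon as one partial sum does. This form also covers the value +∞, which
  -- can occur in base 1.
  value>⇒sum> : 0# < p → (∃[ v ] HasValue d p v × [ x ] <⁺ v) → ∃[ N ] x < S (p ⁻¹) d N
  value>⇒sum> 0<p ([ v ] , conv , [ x<v ])      = below-limit (HasValue⇒IsLimit 0<p conv) x<v
  value>⇒sum> {p} {d} {x} 0<p (⊤⁺ , diverge , _) with diverge x
  ... | N , large = N , <-respʳ-≈ (partialSum≈S 0<p d N) (large N ℕ.≤-refl)

  sum>⇒value> : 0# < p → (∃[ N ] x < S (p ⁻¹) d N) → ∃[ v ] HasValue d p v × [ x ] <⁺ v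
  sum>⇒value> {p} {x} {d} 0<p (N , x<S) with em {∃[ u ] (∀ N → S (p ⁻¹) d N ≤ u)}
  ... | yes (u , bounded) with bounded⇒limit bounded
  ...   | v , lim = [ v ] , IsLimit⇒HasValue 0<p lim , [ <-≤-trans x<S (proj₁ lim N) ]
  sum>⇒value> {p} {x} {d} 0<p (N , x<S) | no unbounded = ⊤⁺ , diverge , [ _ ]<⊤⁺
    where
    diverge : ∀ b → ∃[ N ] ∀ m → N ℕ.≤ m → b < partialSum d p m
    diverge b with em {∃[ N ] b < S (p ⁻¹) d N}
    ... | yes (N , b<S) = N , λ m N≤m → <-respʳ-≈ (sym (partialSum≈S 0<p d m))
                            (<-≤-trans b<S (S-monoʳ (⁻¹-pos 0<p) d N≤m))
    ... | no  none = contradiction (b , λ N → ≮⇒≥ λ lt → none (N , lt)) unbounded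

  module Value {r : Carrier} (0<r : 0# < r) (r<1 : r < 1#) where
    private
      q : Carrier
      q = r ⁻¹

      rq≈1 : r * q ≈ 1#
      rq≈1 = ⁻¹-inverseʳ 0<r

      0≤r^ : ∀ n → 0# ≤ r ^ n
      0≤r^ n = <⇒≤ (^-pos 0<r n)

    -- The value of 1^∞, hence the largest value of any sequence.
    ω : Carrier
    ω = r * (1# - r) ⁻¹

    ω-fixed : r * (1# + ω) ≈ ω
    ω-fixed = begin-equality
      r * (1# + r * i)                ≈⟨ *-congˡ (+-congʳ (⁻¹-inverseʳ (x<y⇒0<y-x r<1))) ⟨
      r * ((1# - r) * i + r * i)
        ≈⟨ solve 2 (λ r i → r :* ((:1 :- r) :* i :+ r :* i) := r :* i) refl r i ⟩
      r * i                           ∎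
      where i = (1# - r) ⁻¹

    0≤ω : 0# ≤ ω
    0≤ω = *-nonneg (<⇒≤ 0<r) (<⇒≤ (⁻¹-pos (x<y⇒0<y-x r<1)))

    S≤ω : ∀ d N → S r d N ≤ ω
    S≤ω d zero    = 0≤ω
    S≤ω d (suc N) = ≤-trans
      (*-monoʳ-≤ (<⇒≤ 0<r) (+-mono-≤ (digit≤1 (d 0)) (S≤ω (d ∘ suc) N)))
      (≈⇒≤ ω-fixed)

    private
      -- The supremum L of the lower bounds of the r ^ N * c satisfies L / r ≤ L.
      null : ∀ {c} → 0# ≤ c → (∀ N → u ≤ r ^ N * c) → u ≤ 0#
      null {u} {c} 0≤c u≤ with complete (λ y → ∀ N → y ≤ r ^ N * c)
                              (0# , λ N → *-nonneg (0≤r^ N) 0≤c)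
                              (1# * c , λ lower → lower 0)
      ... | L , above , least = ≤-trans (above u≤) (≮⇒≥ λ 0<L → irrefl refl (begin-strict
        L           ≈⟨ r*qL L ⟨
        r * (q * L) ≤⟨ *-monoʳ-≤ (<⇒≤ 0<r) (above qL-lower) ⟩
        r * L       <⟨ *-monoˡ-< 0<L r<1 ⟩
        1# * L      ≈⟨ *-identityˡ L ⟩
        L           ∎))
        where
        r*qL : ∀ L → r * (q * L) ≈ L
        r*qL L = trans (sym (*-assoc r q L)) (trans (*-congʳ rq≈1) (*-identityˡ L))
        qL-lower : ∀ N → q * L ≤ r ^ N * c
        qL-lower N = *-cancelˡ-≤ 0<r (begin
          r * (q * L)     ≈⟨ r*qL L ⟩
          L               ≤⟨ least (λ lower → lower (suc N)) ⟩
          r * r ^ N * c   ≈⟨ *-assoc r (r ^ N) c ⟩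
          r * (r ^ N * c) ∎)

    ≤-limit : ∀ {c} → 0# ≤ c → (∀ N → u ≤ v + r ^ N * c) → u ≤ v
    ≤-limit {u} {v} {c} 0≤c close = begin
      u           ≈⟨ solve 2 (λ u v → u := (u :- v) :+ v) refl u v ⟩
      (u - v) + v ≤⟨ +-monoˡ-≤ v (null 0≤c λ N → begin
        u - v                 ≤⟨ +-monoˡ-≤ (- v) (close N) ⟩
        v + r ^ N * c - v     ≈⟨ solve 2 (λ v w → v :+ w :- v := w) refl v (r ^ N * c) ⟩
        r ^ N * c             ∎) ⟩
      0# + v      ≈⟨ +-identityˡ v ⟩
      v           ∎

    val : BinarySeq → Carrier
    val d = proj₁ (bounded⇒limit (S≤ω d))

    val-isLimit : ∀ d → IsLimit r d (val d)
    val-isLimit d = proj₂ (bounded⇒limit (S≤ω d))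

    S≤val : ∀ d N → S r d N ≤ val d
    S≤val d = proj₁ (val-isLimit d)

    val≤ : ∀ d → (∀ N → S r d N ≤ u) → val d ≤ u
    val≤ d = proj₂ (val-isLimit d) _

    val≤ω : ∀ d → val d ≤ ω
    val≤ω d = val≤ d (S≤ω d)

    0≤val : ∀ d → 0# ≤ val d
    0≤val d = S≤val d 0

    val-cong : c ≗ d → val c ≈ val d
    val-cong {c} {d} eq = ≤-antisym
      (val≤ c λ N → ≤-trans (≈⇒≤ (reflexive (S-cong r eq N))) (S≤val d N))
      (val≤ d λ N → ≤-trans (≈⇒≤ (reflexive (≡.sym (S-cong r eq N)))) (S≤val c N))

    val-∷ : ∀ d → val d ≈ r * (digit (d 0) + val (d ∘ suc))
    val-∷ d = IsLimit-unique (val-isLimit d) (above , least)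
      where
      b = digit (d 0)
      above : ∀ N → S r d N ≤ r * (b + val (d ∘ suc))
      above zero    = *-nonneg (<⇒≤ 0<r) (+-nonneg (0≤digit (d 0)) (0≤val (d ∘ suc)))
      above (suc N) = *-monoʳ-≤ (<⇒≤ 0<r) (+-monoʳ-≤ b (S≤val (d ∘ suc) N))
      -- Solving u = r (b + t) for t gives `q * u - b`, the bound on the sums of the tail that
      -- corresponds to the bound `u` on the sums of `d`.
      rescale : ∀ u → r * (b + (q * u - b)) ≈ u
      rescale u = begin-equality
        r * (b + (q * u - b))
          ≈⟨ solve 4 (λ r b q u → r :* (b :+ (q :* u :- b)) := r :* q :* u) refl r b q u ⟩
        r * q * u             ≈⟨ *-congʳ rq≈1 ⟩
        1# * u                ≈⟨ *-identityˡ u ⟩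
        u                     ∎
      least : ∀ u → (∀ N → S r d N ≤ u) → r * (b + val (d ∘ suc)) ≤ u
      least u bounded = ≤-trans
        (*-monoʳ-≤ (<⇒≤ 0<r) (+-monoʳ-≤ b (val≤ (d ∘ suc) λ N → +-cancelʳ-≤ b (*-cancelˡ-≤ 0<r (begin
          r * (S r (d ∘ suc) N + b) ≈⟨ *-congˡ (+-comm _ b) ⟩
          S r d (suc N)             ≤⟨ bounded (suc N) ⟩
          u                         ≈⟨ rescale u ⟨
          r * (b + (q * u - b))     ≈⟨ *-congˡ (+-comm b _) ⟩
          r * (q * u - b + b)       ∎)))))
        (≈⇒≤ (rescale u))

    val-split : ∀ d k → val d ≈ S r d k + r ^ k * val (shift k d)
    val-split d zero    = sym (trans (+-identityˡ _) (*-identityˡ _))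
    val-split d (suc k) = begin-equality
      val d
        ≈⟨ val-∷ d ⟩
      r * (digit (d 0) + val (d ∘ suc))
        ≈⟨ *-congˡ (+-congˡ (val-split (d ∘ suc) k)) ⟩
      r * (digit (d 0) + (S r (d ∘ suc) k + r ^ k * val (shift (suc k) d)))
        ≈⟨ solve 5 (λ r a s p t → r :* (a :+ (s :+ p :* t)) := r :* (a :+ s) :+ r :* p :* t) refl
             r (digit (d 0)) (S r (d ∘ suc) k) (r ^ k) (val (shift (suc k) d)) ⟩
      r * (digit (d 0) + S r (d ∘ suc) k) + r * r ^ k * val (shift (suc k) d) ∎

    val≤S+ω : ∀ d N → val d ≤ S r d N + r ^ N * ω
    val≤S+ω d N = ≤-trans (≈⇒≤ (val-split d N)) (+-monoʳ-≤ _ (*-monoʳ-≤ (0≤r^ N) (val≤ω _)))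

    val-sandwich : ∀ d → (∀ N → S r d N ≤ u) → (∀ N → u ≤ S r d N + r ^ N * ω) → val d ≈ u
    val-sandwich d above below = ≤-antisym (val≤ d above)
      (≤-limit 0≤ω λ N → ≤-trans (below N) (+-monoˡ-≤ _ (S≤val d N)))

    private
      digit-flip : ∀ b → digit b + digit (not b) ≈ 1#
      digit-flip true  = +-identityʳ 1#
      digit-flip false = +-identityˡ 1#

      -- A sequence and its complement add up to 1^∞, whose remainder after N digits is `r ^ N * ω`.
      S-flip : ∀ d N → S r d N + S r (flip d) N + r ^ N * ω ≈ ω
      S-flip d zero    = trans (+-cong (+-identityˡ 0#) (*-identityˡ ω)) (+-identityˡ ω)
      S-flip d (suc N) = begin-equality
        r * (a + s) + r * (b + t) + r * r ^ N * ω
          ≈⟨ solve 7 (λ r a s b t p w → r :* (a :+ s) :+ r :* (b :+ t) :+ r :* p :* w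
               := r :* (a :+ b :+ (s :+ t :+ p :* w))) refl r a s b t (r ^ N) ω ⟩
        r * (a + b + (s + t + r ^ N * ω))
          ≈⟨ *-congˡ (+-cong (digit-flip (d 0)) (S-flip (d ∘ suc) N)) ⟩
        r * (1# + ω)
          ≈⟨ ω-fixed ⟩
        ω ∎
        where
        a = digit (d 0)
        b = digit (not (d 0))
        s = S r (d ∘ suc) N
        t = S r (flip d ∘ suc) N

    val-flip : ∀ d → val (flip d) ≈ ω - val d
    val-flip d = val-sandwich (flip d)
      (λ N → ≤-by (x≤y⇒0≤y-x (val≤S+ω d N)) (begin-equality
        S r (flip d) N + (S r d N + r ^ N * ω - val d)
          ≈⟨ solve 4 (λ t s p v → t :+ (s :+ p :- v) := s :+ t :+ p :- v) refl
               (S r (flip d) N) (S r d N) (r ^ N * ω) (val d) ⟩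
        S r d N + S r (flip d) N + r ^ N * ω - val d
          ≈⟨ +-congʳ (S-flip d N) ⟩
        ω - val d ∎))
      (λ N → ≤-by (x≤y⇒0≤y-x (S≤val d N)) (begin-equality
        ω - val d + (val d - S r d N)
          ≈⟨ +-congʳ (+-congʳ (S-flip d N)) ⟨
        S r d N + S r (flip d) N + r ^ N * ω - val d + (val d - S r d N)
          ≈⟨ solve 4 (λ t s p v → s :+ t :+ p :- v :+ (v :- s) := t :+ p) refl
               (S r (flip d) N) (S r d N) (r ^ N * ω) (val d) ⟩
        S r (flip d) N + r ^ N * ω ∎))

    val-flip-cong : ∀ c d → val c ≈ val d → val (flip c) ≈ val (flip d)
    val-flip-cong c d eq = trans (val-flip c) (trans (+-congˡ (-‿cong eq)) (sym (val-flip d)))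

    private
      val-drop : ∀ k → Agree k c d → c k ≡ false →
                 val c ≈ S r d k + r ^ k * (r * val (shift (suc k) c))
      val-drop {c} {d} k agree cₖ≡0 = begin-equality
        val c
          ≈⟨ val-split c k ⟩
        S r c k + r ^ k * val (shift k c)
          ≈⟨ +-cong (reflexive (S-agree r k agree)) (*-congˡ (val-∷ (shift k c))) ⟩
        S r d k + r ^ k * (r * (digit (shift k c 0) + val (shift k c ∘ suc)))
          ≡⟨ ≡.cong (λ b → S r d k + r ^ k * (r * (digit b + val (shift k c ∘ suc))))
               (≡.trans (shift-zero k c) cₖ≡0) ⟩
        S r d k + r ^ k * (r * (0# + val (shift k c ∘ suc)))
          ≈⟨ +-congˡ (*-congˡ (*-congˡ (trans (+-identityˡ _) (val-cong (shift-suc k c))))) ⟩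
        S r d k + r ^ k * (r * val (shift (suc k) c)) ∎

      S-raise : ∀ k → d k ≡ true → S r d k + r ^ k * (r * 1#) ≈ S r d (suc k)
      S-raise {d} k dₖ≡1 = sym (trans (S-suc r d k)
        (reflexive (≡.cong (λ b → S r d k + r ^ k * (r * digit b)) dₖ≡1)))

    -- At the first difference `c` has 0 and `d` has 1. The whole tail of `c` behind that place
    -- weighs at most as much as this single digit of `d`.
    val≤S : ((k , _) : c <ₗₑₓ d) → val (shift (suc k) c) ≤ 1# → val c ≤ S r d (suc k)
    val≤S {c} {d} (k , agree , lt) small = begin
      val c                                         ≈⟨ val-drop k agree (<⇒false lt) ⟩
      S r d k + r ^ k * (r * val (shift (suc k) c))
        ≤⟨ +-monoʳ-≤ _ (*-monoʳ-≤ (0≤r^ k) (*-monoʳ-≤ (<⇒≤ 0<r) small)) ⟩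
      S r d k + r ^ k * (r * 1#)                    ≈⟨ S-raise {d} k (<⇒true lt) ⟩
      S r d (suc k)                                 ∎

    val<S : ((k , _) : c <ₗₑₓ d) → val (shift (suc k) c) < 1# → val c < S r d (suc k)
    val<S {c} {d} (k , agree , lt) small = begin-strict
      val c                                         ≈⟨ val-drop k agree (<⇒false lt) ⟩
      S r d k + r ^ k * (r * val (shift (suc k) c))
        <⟨ +-monoʳ-< _ (*-monoʳ-< (^-pos 0<r k) (*-monoʳ-< 0<r small)) ⟩
      S r d k + r ^ k * (r * 1#)                    ≈⟨ S-raise {d} k (<⇒true lt) ⟩
      S r d (suc k)                                 ∎

    SmallZeroTails : Pred BinarySeq 0ℓ
    SmallZeroTails d = ∀ k → d k ≡ false → val (shift (suc k) d) < 1#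

    val-mono-< : SmallZeroTails c → c <ₗₑₓ d → val c < val d
    val-mono-< {c} {d} small lt@(k , _ , lt′) =
      <-≤-trans (val<S lt (small k (<⇒false lt′))) (S≤val d (suc k))

    Unique : Pred BinarySeq 0ℓ
    Unique d = ∀ c → val c ≈ val d → d ≗ c

    -- A lexicographically larger sequence has a strictly larger value. A smaller one is handled by
    -- complementing both, which reverses the order and replaces each value by its difference from
    -- `ω`.
    small⇒unique : ∀ {d} → SmallZeroTails d → SmallZeroTails (flip d) → Unique d
    small⇒unique {d} small small′ c eq with lex-compare em d c
    ... | inj₁ d≗c        = d≗c
    ... | inj₂ (inj₁ d<c) = contradiction (val-mono-< small d<c) (irrefl (sym eq))
    ... | inj₂ (inj₂ c<d) = contradiction (val-mono-< small′ (<ₗₑₓ-flip c<d))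
                              (irrefl (val-flip-cong d c (sym eq)))

    unique-flip : ∀ {d} → Unique d → Unique (flip d)
    unique-flip {d} unique c eq i = ≡.trans
      (≡.cong not (unique (flip c) (trans (val-flip-cong c (flip d) eq) (val-cong flip-flip)) i))
      (not-involutive (c i))

    module Greedy (1≤ω : 1# ≤ ω) where
      private
        step : Carrier → Bool × Carrier
        step y with ≤-or-> r y
        ... | inj₁ _ = true  , q * y - 1#
        ... | inj₂ _ = false , q * y

        greedy : Carrier → BinarySeq
        greedy y zero    = proj₁ (step y)
        greedy y (suc i) = greedy (proj₂ (step y)) i

        step-eq : ∀ y → y ≈ r * (digit (proj₁ (step y)) + proj₂ (step y))
        step-eq y with ≤-or-> r y
        ... | inj₁ _ = sym (begin-equality
          r * (1# + (q * y - 1#))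
            ≈⟨ solve 3 (λ r q y → r :* (:1 :+ (q :* y :- :1)) := r :* q :* y) refl r q y ⟩
          r * q * y               ≈⟨ *-congʳ rq≈1 ⟩
          1# * y                  ≈⟨ *-identityˡ y ⟩
          y                       ∎)
        ... | inj₂ _ = sym (begin-equality
          r * (0# + q * y)
            ≈⟨ solve 3 (λ r q y → r :* (:0 :+ q :* y) := r :* q :* y) refl r q y ⟩
          r * q * y               ≈⟨ *-congʳ rq≈1 ⟩
          1# * y                  ≈⟨ *-identityˡ y ⟩
          y                       ∎)

        -- After a digit 1 the bound is the fixed-point equation of `ω`. After a digit 0 the
        -- remainder is below 1, and `1≤ω` keeps it in range.
        step-range : ∀ y → 0# ≤ y → y ≤ ω → 0# ≤ proj₂ (step y) × proj₂ (step y) ≤ ω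
        step-range y 0≤y y≤ω with ≤-or-> r y
        ... | inj₁ r≤y =
          +-cancelʳ-≤ 1# (begin
            0# + 1#       ≈⟨ +-identityˡ 1# ⟩
            1#            ≈⟨ trans (*-comm q r) rq≈1 ⟨
            q * r         ≤⟨ *-monoʳ-≤ (<⇒≤ (⁻¹-pos 0<r)) r≤y ⟩
            q * y         ≈⟨ solve 1 (λ z → z := z :- :1 :+ :1) refl (q * y) ⟩
            q * y - 1# + 1# ∎) ,
          +-cancelʳ-≤ 1# (begin
            q * y - 1# + 1#    ≈⟨ solve 1 (λ z → z :- :1 :+ :1 := z) refl (q * y) ⟩
            q * y              ≤⟨ *-monoʳ-≤ (<⇒≤ (⁻¹-pos 0<r)) y≤ω ⟩
            q * ω              ≈⟨ *-congˡ ω-fixed ⟨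
            q * (r * (1# + ω))
              ≈⟨ solve 3 (λ q r z → q :* (r :* z) := r :* q :* z) refl q r (1# + ω) ⟩
            r * q * (1# + ω)   ≈⟨ trans (*-congʳ rq≈1) (*-identityˡ _) ⟩
            1# + ω             ≈⟨ +-comm 1# ω ⟩
            ω + 1#             ∎)
        ... | inj₂ y<r = *-nonneg (<⇒≤ (⁻¹-pos 0<r)) 0≤y , (begin
            q * y  ≤⟨ *-monoʳ-≤ (<⇒≤ (⁻¹-pos 0<r)) (<⇒≤ y<r) ⟩
            q * r  ≈⟨ trans (*-comm q r) rq≈1 ⟩
            1#     ≤⟨ 1≤ω ⟩
            ω      ∎)

        greedy-above : ∀ y → 0# ≤ y → y ≤ ω → ∀ N → S r (greedy y) N ≤ y
        greedy-above y 0≤y y≤ω zero    = 0≤y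
        greedy-above y 0≤y y≤ω (suc N) = ≤-trans
          (*-monoʳ-≤ (<⇒≤ 0<r) (+-monoʳ-≤ _ (greedy-above (proj₂ (step y))
            (proj₁ (step-range y 0≤y y≤ω)) (proj₂ (step-range y 0≤y y≤ω)) N)))
          (≈⇒≤ (sym (step-eq y)))

        greedy-below : ∀ y → 0# ≤ y → y ≤ ω → ∀ N → y ≤ S r (greedy y) N + r ^ N * ω
        greedy-below y 0≤y y≤ω zero    = ≤-trans y≤ω (≈⇒≤ (sym (trans (+-identityˡ _) (*-identityˡ _))))
        greedy-below y 0≤y y≤ω (suc N) = begin
          y
            ≈⟨ step-eq y ⟩
          r * (b + y′)
            ≤⟨ *-monoʳ-≤ (<⇒≤ 0<r) (+-monoʳ-≤ b (greedy-below y′ (proj₁ range) (proj₂ range) N)) ⟩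
          r * (b + (S r (greedy y′) N + r ^ N * ω))
            ≈⟨ solve 5 (λ r a s p t → r :* (a :+ (s :+ p :* t)) := r :* (a :+ s) :+ r :* p :* t) refl
                 r b (S r (greedy y′) N) (r ^ N) ω ⟩
          r * (b + S r (greedy y′) N) + r * r ^ N * ω ∎
          where
          b = digit (proj₁ (step y))
          y′ = proj₂ (step y)
          range = step-range y 0≤y y≤ω

      expansion : ∀ y → 0# ≤ y → y ≤ ω → ∃[ d ] val d ≈ y
      expansion y 0≤y y≤ω = greedy y ,
        val-sandwich (greedy y) (greedy-above y 0≤y y≤ω) (greedy-below y 0≤y y≤ω)

      private
        -- Replacing the 0 by 1 costs 1 from the value of the tail, and what is left has a greedy
        -- expansion. Thus a tail of value at least 1 behind a 0 yields a second expansion.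
        raise : ∀ k {d} → d k ≡ false → 1# ≤ val (shift (suc k) d) →
                ∃[ c ] val c ≈ val d × c k ≡ true
        raise zero {d} d₀≡0 1≤v = true ∷ proj₁ g , (begin-equality
          val (true ∷ proj₁ g)                 ≈⟨ val-∷ (true ∷ proj₁ g) ⟩
          r * (1# + val (proj₁ g))             ≈⟨ *-congˡ (+-congˡ (proj₂ g)) ⟩
          r * (1# + (val (d ∘ suc) - 1#))
            ≈⟨ *-congˡ (solve 1 (λ z → :1 :+ (z :- :1) := :0 :+ z) refl (val (d ∘ suc))) ⟩
          r * (0# + val (d ∘ suc))
            ≡⟨ ≡.cong (λ b → r * (digit b + val (d ∘ suc))) (≡.sym d₀≡0) ⟩
          r * (digit (d 0) + val (d ∘ suc))    ≈⟨ val-∷ d ⟨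
          val d                                ∎) , ≡.refl
          where
          g : ∃[ g ] val g ≈ val (d ∘ suc) - 1#
          g = expansion (val (d ∘ suc) - 1#) (x≤y⇒0≤y-x 1≤v)
            (≤-trans (≤-by (<⇒≤ 0<1) (solve 1 (λ z → z :- :1 :+ :1 := z) refl (val (d ∘ suc))))
              (val≤ω _))
        raise (suc k) {d} dₖ≡0 1≤v = prepend (raise k {d ∘ suc} dₖ≡0 1≤v)
          where
          prepend : ∃[ c ] val c ≈ val (d ∘ suc) × c k ≡ true → ∃[ c ] val c ≈ val d × c (suc k) ≡ true
          prepend (c , eq , cₖ≡1) = d 0 ∷ c ,
            trans (val-∷ (d 0 ∷ c)) (trans (*-congˡ (+-congˡ eq)) (sym (val-∷ d))) , cₖ≡1

      unique⇒small : ∀ {d} → Unique d → SmallZeroTails d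
      unique⇒small unique k dₖ≡0 = ≰⇒> λ 1≤v → let (c , eq , cₖ≡1) = raise k dₖ≡0 1≤v in
        false≢true dₖ≡0 (≡.trans (unique c eq k) cₖ≡1)

    -- If the tail exceeded `b`, then at the first difference `b` would have a 0 followed by a tail
    -- of value at most 1. The value of `b` would then be at most that of the given tail, which
    -- would therefore be at least 1.
    small⇒strict : ∀ {b d} → (∀ N → S r b N ≤ 1#) → ZeroTails b b → 1# ≤ val b →
                   SmallZeroTails d → ∀ k → d k ≡ false → shift (suc k) d <ₗₑₓ b
    small⇒strict {b} {d} Sb≤1 tails 1≤b small k dₖ≡0 with lex-compare em (shift (suc k) d) b
    ... | inj₁ eq        = contradiction (small k dₖ≡0) (≤⇒≯ (≤-trans 1≤b (≈⇒≤ (sym (val-cong eq)))))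
    ... | inj₂ (inj₁ lt) = lt
    ... | inj₂ (inj₂ lt@(l , _ , lt′)) = contradiction (small k dₖ≡0) (≤⇒≯ (≤-trans 1≤b
            (≤-trans (val≤S lt (val≤ _ (S-ZeroTails 0<r Sb≤1
               (ZeroTails-shift (suc l) tails)
               (tails l (<⇒false lt′)))))
              (S≤val _ (suc l)))))

-- Continuity in the base

module Continuity (em : ExcludedMiddle 0ℓ) (R : CompleteOrderedField) where
  open OrderedField R
  open PartialSums R
  open LimitTheory em R
  open Expansions R using (digit)
  open Reasoning

  -- A finite sum is continuous in its base. The induction needs only that a strict lower bound
  -- survives a small decrease of `s`; for negative `u` any positive `r` below `s` will do.
  S-leftContinuous : ∀ {s} → 0# < s → ∀ N d {u} → u < S s d N →
                     ∃[ r ] 0# < r × r < s × u < S r d N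
  S-leftContinuous {s} 0<s zero    d u<0 = let (r , 0<r , r<s) = dense 0<s in r , 0<r , r<s , u<0
  S-leftContinuous {s} 0<s (suc N) d {u} u<S with ≤-or-> 0# u
  ... | inj₂ u<0 = let (r , 0<r , r<s) = dense 0<s in
        r , 0<r , r<s , <-≤-trans u<0 (S-nonneg 0<r d (suc N))
  ... | inj₁ 0≤u = larger
        (S-leftContinuous 0<s N (d ∘ suc) (+-cancelʳ-< b (<-respˡ-≈ (w-b+b w)
          (<-respʳ-≈ (+-comm b _) (proj₂ (proj₂ mid))))))
        (dense ratio<s)
    where
    b = digit (d 0)
    T = S s (d ∘ suc) N
    v = u * s ⁻¹
    sv≈u : s * v ≈ u
    sv≈u = trans (solve 3 (λ s u i → s :* (u :* i) := s :* i :* u) refl s u (s ⁻¹))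
      (trans (*-congʳ (⁻¹-inverseʳ 0<s)) (*-identityˡ u))
    w-b+b : ∀ w → w ≈ w - b + b
    w-b+b w = solve 2 (λ w b → w := w :- b :+ b) refl w b
    -- The value `w` splits the slack: u < r w holds once r > u/w, where u/w < s, and w < b + T
    -- leaves the induction hypothesis a strict inequality for the tail.
    mid : ∃[ w ] v < w × w < b + T
    mid = dense (*-cancelˡ-< 0<s (<-respˡ-≈ (sym sv≈u) u<S))
    w = proj₁ mid
    0<w : 0# < w
    0<w = ≤-<-trans (*-nonneg 0≤u (<⇒≤ (⁻¹-pos 0<s))) (proj₁ (proj₂ mid))
    w*ratio : w * (u * w ⁻¹) ≈ u
    w*ratio = trans (solve 3 (λ s u i → s :* (u :* i) := s :* i :* u) refl w u (w ⁻¹))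
      (trans (*-congʳ (⁻¹-inverseʳ 0<w)) (*-identityˡ u))
    ratio<s : u * w ⁻¹ < s
    ratio<s = *-cancelˡ-< 0<w (begin-strict
      w * (u * w ⁻¹) ≈⟨ w*ratio ⟩
      u              ≈⟨ sv≈u ⟨
      s * v          <⟨ *-monoʳ-< 0<s (proj₁ (proj₂ mid)) ⟩
      s * w          ≈⟨ *-comm s w ⟩
      w * s          ∎)
    combine : ∀ {r r₁ r₂} → 0# < r₁ → r₁ ≤ r → r₂ ≤ r → w - b < S r₁ (d ∘ suc) N → u * w ⁻¹ < r₂ →
              u < S r d (suc N)
    combine {r} {r₁} {r₂} 0<r₁ r₁≤r r₂≤r w-b<S ratio<r₂ = begin-strict
      u                             ≈⟨ w*ratio ⟨
      w * (u * w ⁻¹)                <⟨ *-monoʳ-< 0<w ratio<r₂ ⟩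
      w * r₂                        ≤⟨ *-monoʳ-≤ (<⇒≤ 0<w) r₂≤r ⟩
      w * r                         ≈⟨ *-comm w r ⟩
      r * w                         ≤⟨ *-monoʳ-≤ (≤-trans (<⇒≤ 0<r₁) r₁≤r) (begin
        w                             ≈⟨ w-b+b w ⟩
        w - b + b                     ≤⟨ +-monoˡ-≤ b (<⇒≤ w-b<S) ⟩
        S r₁ (d ∘ suc) N + b          ≤⟨ +-monoˡ-≤ b (S-monoˡ 0<r₁ r₁≤r (d ∘ suc) N) ⟩
        S r (d ∘ suc) N + b           ≈⟨ +-comm _ b ⟩
        b + S r (d ∘ suc) N           ∎) ⟩
      r * (b + S r (d ∘ suc) N)     ∎
    larger : ∃[ r ] 0# < r × r < s × w - b < S r (d ∘ suc) N → ∃[ r ] u * w ⁻¹ < r × r < s →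
             ∃[ r ] 0# < r × r < s × u < S r d (suc N)
    larger (r₁ , 0<r₁ , r₁<s , below₁) (r₂ , below₂ , r₂<s) with ≤-or-> r₁ r₂
    ... | inj₁ r₁≤r₂ = r₂ , <-≤-trans 0<r₁ r₁≤r₂ , r₂<s , combine 0<r₁ r₁≤r₂ ≤-refl below₁ below₂
    ... | inj₂ r₂<r₁ = r₁ , 0<r₁ , r₁<s , combine 0<r₁ ≤-refl (<⇒≤ r₂<r₁) below₁ below₂

  module _ {ρ} (0<ρ : 0# < ρ) (ρ<1 : ρ < 1#) where
    open Value 0<ρ ρ<1

    -- The solution K of K = 1 + ω + ρ K, the recursion under which the induction on the number of
    -- terms closes.
    lipschitz : Carrier
    lipschitz = (1# + ω) * (1# - ρ) ⁻¹

    lipschitz-pos : 0# < lipschitz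
    lipschitz-pos = *-pos (<-≤-trans 0<1 (≤-by 0≤ω refl)) (⁻¹-pos (x<y⇒0<y-x ρ<1))

    lipschitz-fixed : 1# + ω + ρ * lipschitz ≈ lipschitz
    lipschitz-fixed = begin-equality
      1# + ω + ρ * ((1# + ω) * i)
        ≈⟨ solve 3 (λ z r i → z :+ r :* (z :* i) := z :* :1 :+ r :* (z :* i)) refl (1# + ω) ρ i ⟩
      (1# + ω) * 1# + ρ * ((1# + ω) * i)   ≈⟨ +-congʳ (*-congˡ (⁻¹-inverseʳ (x<y⇒0<y-x ρ<1))) ⟨
      (1# + ω) * ((1# - ρ) * i) + ρ * ((1# + ω) * i)
        ≈⟨ solve 3 (λ z r i → z :* ((:1 :- r) :* i) :+ r :* (z :* i) := z :* i) refl (1# + ω) ρ i ⟩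
      (1# + ω) * i                         ∎
      where i = (1# - ρ) ⁻¹

    S-lipschitz : ∀ {s h} → 0# < s → 0# ≤ h → s + h ≤ ρ → ∀ d N →
                  S (s + h) d N ≤ S s d N + h * lipschitz
    S-lipschitz 0<s 0≤h s+h≤ρ d zero =
      ≤-trans (*-nonneg 0≤h (<⇒≤ lipschitz-pos)) (≈⇒≤ (sym (+-identityˡ _)))
    S-lipschitz {s} {h} 0<s 0≤h s+h≤ρ d (suc N) = begin
      (s + h) * (b + S (s + h) (d ∘ suc) N)
        ≤⟨ *-monoʳ-≤ (<⇒≤ 0<s+h) (+-monoʳ-≤ b (S-lipschitz 0<s 0≤h s+h≤ρ (d ∘ suc) N)) ⟩
      (s + h) * (b + (T + h * K))
        ≈⟨ solve 5 (λ s h b t k → (s :+ h) :* (b :+ (t :+ h :* k))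
             := s :* (b :+ t) :+ h :* (b :+ t :+ (s :+ h) :* k))
             refl s h b T K ⟩
      s * (b + T) + h * (b + T + (s + h) * K)
        ≤⟨ +-monoʳ-≤ _ (*-monoʳ-≤ 0≤h (+-mono-≤
             (+-mono-≤ (digit≤1 (d 0)) (≤-trans
               (S-monoˡ 0<s (≤-trans (≤-by 0≤h refl) s+h≤ρ) (d ∘ suc) N) (S≤ω (d ∘ suc) N)))
             (*-monoˡ-≤ (<⇒≤ lipschitz-pos) s+h≤ρ))) ⟩
      s * (b + T) + h * (1# + ω + ρ * K)
        ≈⟨ +-congˡ (*-congˡ lipschitz-fixed) ⟩
      s * (b + T) + h * K ∎
      where
      b = digit (d 0)
      T = S s (d ∘ suc) N
      K = lipschitz
      0<s+h : 0# < s + h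
      0<s+h = <-≤-trans 0<s (≤-by 0≤h refl)

  -- s is the supremum of the r for which the series at r is at most x.
  intermediate-value : ∀ {r₀ r₁ x} d → 0# < r₀ → (∀ N → S r₀ d N ≤ x) →
    r₁ ≤ 1# → 0# < r₁ → (∃[ N ] x < S r₁ d N) →
    ∃[ s ] r₀ ≤ s × s < r₁ × IsLimit s d x
  intermediate-value {r₀} {r₁} {x} d 0<r₀ below r₁≤1 0<r₁ (N₁ , x<S₁) =
    s , r₀≤s , s<r₁ , s-below , λ u bounded → ≮⇒≥ (not-less u bounded)
    where
    Below : Pred Carrier 0ℓ
    Below r = 0# < r × (∀ N → S r d N ≤ x)
    separated : ∀ {r r′} N → Below r → 0# < r′ → x < S r′ d N → r < r′
    separated N (0<r , r-below) 0<r′ x<S = ≰⇒> λ r′≤r →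
      ≤⇒≯ (≤-trans (S-monoˡ 0<r′ r′≤r d N) (r-below N)) x<S
    supremum : ∃ (IsSupremum Below)
    supremum = complete Below (r₀ , 0<r₀ , below) (r₁ , λ r∈ → <⇒≤ (separated N₁ r∈ 0<r₁ x<S₁))
    s = proj₁ supremum
    r₀≤s : r₀ ≤ s
    r₀≤s = proj₁ (proj₂ supremum) (0<r₀ , below)
    0<s = <-≤-trans 0<r₀ r₀≤s
    s-below : ∀ N → S s d N ≤ x
    s-below N = ≮⇒≥ λ x<S → let (r , 0<r , r<s , x<Sr) = S-leftContinuous 0<s N d x<S in
      ≤⇒≯ (proj₂ (proj₂ supremum) (λ r∈ → <⇒≤ (separated N r∈ 0<r x<Sr))) r<s
    s<r₁ : s < r₁
    s<r₁ = separated N₁ (0<s , s-below) 0<r₁ x<S₁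
    not-less : ∀ u → (∀ N → S s d N ≤ u) → ¬ u < x
    not-less u bounded u<x =
      -- Since `r₁` may be 1, the Lipschitz bound is taken at some ρ strictly between `s` and `r₁`.
      let (ρ , s<ρ , ρ<r₁) = dense s<r₁
          0<ρ = <-trans 0<s s<ρ
          ρ<1 = <-≤-trans ρ<r₁ r₁≤1
          K = lipschitz 0<ρ ρ<1
          0<K = lipschitz-pos 0<ρ ρ<1
          -- The increment stays within ρ and raises the sums by at most x - u, so s + h would still
          -- satisfy `Below`, above its supremum.
          (h , 0<h , h≤ , h≤′) = min-pos (x<y⇒0<y-x s<ρ) (*-pos (x<y⇒0<y-x u<x) (⁻¹-pos 0<K))
          s+h≤ρ : s + h ≤ ρ
          s+h≤ρ = ≤-trans (+-monoʳ-≤ s h≤) (≈⇒≤ (solve 2 (λ s r → s :+ (r :- s) := r) refl s ρ))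
          hK≤ : h * K ≤ x - u
          hK≤ = ≤-trans (*-monoˡ-≤ (<⇒≤ 0<K) h≤′) (≈⇒≤ (trans
            (solve 3 (λ y i k → y :* i :* k := y :* (k :* i)) refl (x - u) (K ⁻¹) K)
            (trans (*-congˡ (⁻¹-inverseʳ 0<K)) (*-identityʳ _))))
      in ≤⇒≯ (proj₁ (proj₂ supremum) (<-trans 0<s (<-by 0<h refl) , λ N → (begin
        S (s + h) d N   ≤⟨ S-lipschitz 0<ρ ρ<1 0<s (<⇒≤ 0<h) s+h≤ρ d N ⟩
        S s d N + h * K ≤⟨ +-mono-≤ (bounded N) hK≤ ⟩
        u + (x - u)     ≈⟨ solve 2 (λ u x → u :+ (x :- u) := x) refl u x ⟩
        x               ∎))) (<-by 0<h refl)

-- Unique expansions and the critical bases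

module UniqueExpansions (em : ExcludedMiddle 0ℓ) (R : CompleteOrderedField) where
  open OrderedField R
  open PartialSums R
  open LimitTheory em R
  open Expansions R using (2#; IsExpansion; HasUniqueExpansion; 𝒰)
  open Reasoning

  private variable
    u x : Carrier

  ⁻¹-anti-< : ∀ {x y} → 0# < x → x < y → y ⁻¹ < x ⁻¹
  ⁻¹-anti-< {x} {y} 0<x x<y = *-cancelˡ-< (*-pos 0<x 0<y) (begin-strict
    x * y * y ⁻¹   ≈⟨ *-assoc x y (y ⁻¹) ⟩
    x * (y * y ⁻¹) ≈⟨ trans (*-congˡ (⁻¹-inverseʳ 0<y)) (*-identityʳ x) ⟩
    x              <⟨ x<y ⟩
    y              ≈⟨ trans (*-congˡ (⁻¹-inverseʳ 0<x)) (*-identityʳ y) ⟨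
    y * (x * x ⁻¹) ≈⟨ solve 3 (λ y x i → y :* (x :* i) := x :* y :* i) refl y x (x ⁻¹) ⟩
    x * y * x ⁻¹   ∎)
    where 0<y = <-trans 0<x x<y

  ⁻¹-anti-≤ : ∀ {x y} → 0# < x → x ≤ y → y ⁻¹ ≤ x ⁻¹
  ⁻¹-anti-≤ 0<x (inj₁ x<y) = <⇒≤ (⁻¹-anti-< 0<x x<y)
  ⁻¹-anti-≤ 0<x (inj₂ x≈y) = ≈⇒≤ (⁻¹-cong (sym x≈y))

  ⁻¹-involutive : ∀ {x} → 0# < x → x ⁻¹ ⁻¹ ≈ x
  ⁻¹-involutive {x} 0<x = ⁻¹-unique (⁻¹-pos 0<x) (trans (*-comm _ _) (⁻¹-inverseʳ 0<x))

  ⁻¹*<1 : ∀ {x y} → 0# < x → x < y → y ⁻¹ * x < 1#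
  ⁻¹*<1 {x} {y} 0<x x<y = <-respʳ-≈ (trans (*-comm _ _) (⁻¹-inverseʳ (<-trans 0<x x<y)))
    (*-monoʳ-< (⁻¹-pos (<-trans 0<x x<y)) x<y)

  1⁻¹≈1 : 1# ⁻¹ ≈ 1#
  1⁻¹≈1 = ⁻¹-unique 0<1 (*-identityˡ 1#)

  0<base : ∀ {t} → 1# < t → 0# < t
  0<base = <-trans 0<1

  -- Passing from base p to t multiplies the i-th term by (p/t)^i, which is at most p/t. This factor
  -- later turns a bound by 1 into a strict one.
  scaled-bound : ∀ {p t} → 0# < p → p < t → (∀ N → S (p ⁻¹) d N ≤ u) → ∀ N → S (t ⁻¹) d N ≤ t ⁻¹ * p * u
  scaled-bound {d} {u} {p} {t} 0<p p<t bounded N = *-cancelˡ-≤ (⁻¹-pos 0<p) (begin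
    p ⁻¹ * S (t ⁻¹) d N   ≤⟨ S-scale (⁻¹-pos 0<t) (<⇒≤ (⁻¹-anti-< 0<p p<t)) d N ⟩
    t ⁻¹ * S (p ⁻¹) d N   ≤⟨ *-monoʳ-≤ (<⇒≤ (⁻¹-pos 0<t)) (bounded N) ⟩
    t ⁻¹ * u              ≈⟨ trans (*-congʳ (⁻¹-inverseʳ 0<p)) (*-identityˡ _) ⟨
    p * p ⁻¹ * (t ⁻¹ * u)
      ≈⟨ solve 4 (λ p i j u → p :* i :* (j :* u) := i :* (j :* p :* u)) refl p (p ⁻¹) (t ⁻¹) u ⟩
    p ⁻¹ * (t ⁻¹ * p * u) ∎)
    where 0<t = <-trans 0<p p<t

  -- Otherwise the sums in base p would be at most x, and the value in base t at most (p/t) x < x.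
  -- The argument also covers p = 1.
  smaller-base-exceeds : ∀ {p t} → 0# < p → p < t → 0# < x → IsLimit (t ⁻¹) d x → ∃[ N ] x < S (p ⁻¹) d N
  smaller-base-exceeds {x} {d} {p} {t} 0<p p<t 0<x (_ , least) with em {∃[ N ] x < S (p ⁻¹) d N}
  ... | yes found = found
  ... | no none   = contradiction
        (least _ (scaled-bound 0<p p<t λ N → ≮⇒≥ λ lt → none (N , lt)))
        (λ le → ≤⇒≯ le (<-respʳ-≈ (*-identityˡ x) (*-monoˡ-< 0<x (⁻¹*<1 0<p p<t))))

  module Base {t : Carrier} (1<t : 1# < t) where
    0<t = 0<base 1<t

    0<t⁻¹ : 0# < t ⁻¹
    0<t⁻¹ = ⁻¹-pos 0<t

    t⁻¹<1 : t ⁻¹ < 1#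
    t⁻¹<1 = <-respʳ-≈ 1⁻¹≈1 (⁻¹-anti-< 0<1 1<t)

    open Value 0<t⁻¹ t⁻¹<1 public

    ω≈[t-1]⁻¹ : ω ≈ (t - 1#) ⁻¹
    ω≈[t-1]⁻¹ = sym (⁻¹-unique (x<y⇒0<y-x 1<t) (begin-equality
      (t - 1#) * (t ⁻¹ * i)
        ≈⟨ solve 3 (λ t r i → (t :- :1) :* (r :* i) := (t :* r :- r) :* i) refl t (t ⁻¹) i ⟩
      (t * t ⁻¹ - t ⁻¹) * i     ≈⟨ *-congʳ (+-congʳ (⁻¹-inverseʳ 0<t)) ⟩
      (1# - t ⁻¹) * i           ≈⟨ ⁻¹-inverseʳ (x<y⇒0<y-x t⁻¹<1) ⟩
      1#                        ∎))
      where i = (1# - t ⁻¹) ⁻¹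

    1≤ω : t < 2# → 1# ≤ ω
    1≤ω t<2 = ≤-trans (≤-trans (≈⇒≤ (sym 1⁻¹≈1)) (⁻¹-anti-≤ (x<y⇒0<y-x 1<t)
        (+-cancelʳ-≤ 1# (≤-trans (≈⇒≤ (solve 1 (λ t → t :- :1 :+ :1 := t) refl t)) (<⇒≤ t<2)))))
      (≈⇒≤ (sym ω≈[t-1]⁻¹))

    expansion⇒val : IsExpansion t x d → val d ≈ x
    expansion⇒val {x} {d} exp = IsLimit-unique (val-isLimit d) (HasValue⇒IsLimit 0<t exp)

    val⇒expansion : val d ≈ x → IsExpansion t x d
    val⇒expansion {d} eq = IsLimit⇒HasValue 0<t (IsLimit-resp eq (val-isLimit d))

    unique-elim : HasUniqueExpansion t x → ∃[ d ] val d ≈ x × Unique d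
    unique-elim (d , exp , unique) =
      d , expansion⇒val exp , λ c eq → unique (val⇒expansion (trans eq (expansion⇒val exp)))

    unique-intro : val d ≈ x → Unique d → HasUniqueExpansion t x
    unique-intro {d} eq unique =
      d , val⇒expansion eq , λ {c} exp → unique c (trans (expansion⇒val exp) (sym eq))

    𝒰-intro : HasUniqueExpansion t x → x ∈ 𝒰 t
    𝒰-intro {x} has@(d , exp , _) =
      ≤-trans (0≤val d) (≈⇒≤ (expansion⇒val exp)) ,
      ≤-trans (≈⇒≤ (sym (expansion⇒val exp))) (≤-trans (val≤ω d) (≈⇒≤ ω≈[t-1]⁻¹)) ,
      has

-- Quasi-greedy expansions in the critical bases

module CriticalBases (em : ExcludedMiddle 0ℓ) (R : CompleteOrderedField)
  (q : ℕ → CompleteOrderedField.Carrier R) (critical : Expansions.IsCriticalBases R q) where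
  open OrderedField R
  open PartialSums R
  open LimitTheory em R
  open UniqueExpansions em R
  open Expansions R using (2#; digit; Window)
  open Expansions.IsCriticalBases critical
  open Reasoning

  1≤q : ∀ j → 1# ≤ q j
  1≤q zero    = ≈⇒≤ (sym q₀≈1)
  1≤q (suc j) = <⇒≤ (1<qₙ (suc j) (s≤s z≤n))

  0<q : ∀ j → 0# < q j
  0<q j = <-≤-trans 0<1 (1≤q j)

  0<q⁻¹ : ∀ j → 0# < q j ⁻¹
  0<q⁻¹ j = ⁻¹-pos (0<q j)

  q⁻¹≤1 : ∀ j → q j ⁻¹ ≤ 1#
  q⁻¹≤1 j = ≤-trans (⁻¹-anti-≤ 0<1 (1≤q j)) (≈⇒≤ 1⁻¹≈1)

  private
    S-τ : ∀ j → S (q j ⁻¹) (τ ∘ suc) (2 ℕ.^ j) ≈ 1#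
    -- The base 1 fits the pattern as well: the sum is the single term with digit `τ 1` = 1.
    S-τ zero    = begin-equality
      q 0 ⁻¹ * (1# + 0#) ≈⟨ trans (*-congˡ (+-identityʳ 1#)) (*-identityʳ _) ⟩
      q 0 ⁻¹             ≈⟨ ⁻¹-cong q₀≈1 ⟩
      1# ⁻¹              ≈⟨ 1⁻¹≈1 ⟩
      1#                 ∎
    S-τ (suc j) = trans (sym (partialSum≈S (0<q (suc j)) (τ ∘ suc) (2 ℕ.^ suc j)))
      (sym (root (suc j) (s≤s z≤n)))

    change-last : ∀ r c d M → Agree M c d → c M ≡ true → d M ≡ false →
                  S r d (suc M) + r ^ suc M ≈ S r c (suc M)
    change-last r c d M agree c≡1 d≡0 = begin-equality
      S r d (suc M) + r * r ^ M
        ≈⟨ +-congʳ (S-suc r d M) ⟩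
      S r d M + r ^ M * (r * digit (d M)) + r * r ^ M
        ≡⟨ ≡.cong₂ (λ s b → s + r ^ M * (r * digit b) + r * r ^ M) (≡.sym (S-agree r M agree)) d≡0 ⟩
      S r c M + r ^ M * (r * 0#) + r * r ^ M
        ≈⟨ solve 3 (λ s p r → s :+ p :* (r :* :0) :+ r :* p := s :+ p :* (r :* :1))
             refl (S r c M) (r ^ M) r ⟩
      S r c M + r ^ M * (r * 1#)
        ≡⟨ ≡.cong (λ b → S r c M + r ^ M * (r * digit b)) (≡.sym c≡1) ⟩
      S r c M + r ^ M * (r * digit (c M))
        ≈⟨ S-suc r c M ⟨
      S r c (suc M) ∎

    pred-block : ∀ j → ∃[ M ] suc M ≡ 2 ℕ.^ j
    pred-block j with 2 ℕ.^ j | ℕ.m^n>0 2 j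
    ... | suc M | _ = M , ≡.refl

  -- The block of `quasi j` is that of the Thue-Morse sequence with the last digit lowered from 1 to
  -- 0. The term lost is the last power.
  S-quasi-block : ∀ j → S (q j ⁻¹) (quasi j) (2 ℕ.^ j) + (q j ⁻¹) ^ (2 ℕ.^ j) ≈ 1#
  S-quasi-block j with pred-block j
  ... | M , eq = ≡.subst (λ L → S (q j ⁻¹) (quasi j) L + (q j ⁻¹) ^ L ≈ 1#) eq (trans
    (change-last (q j ⁻¹) (τ ∘ suc) (quasi j) M
      (λ i i<M → ≡.sym (periodic-τ j (suc i) (≡.subst (suc i ℕ.<_) eq (s≤s i<M))))
      (≡.trans (≡.cong τ eq) (τ-2^m j))
      (≡.trans (≡.cong (periodic j) (≡.trans eq (≡.sym (ℕ.+-identityʳ _))))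
        (≡.trans (periodic-shift j 0) (periodic-zero j))))
    (trans (reflexive (≡.cong (S (q j ⁻¹) (τ ∘ suc)) eq)) (S-τ j)))

  -- By periodicity the sum of k blocks falls short of 1 by exactly the last power of `r`, and N
  -- digits lie within N blocks.
  S-quasi≤1 : ∀ j N → S (q j ⁻¹) (quasi j) N ≤ 1#
  S-quasi≤1 j N = ≤-trans (S-monoʳ (0<q⁻¹ j) (quasi j) (ℕ.m≤m*n N M {{ℕ.>-nonZero (ℕ.m^n>0 2 j)}}))
    (≤-by (<⇒≤ (^-pos (0<q⁻¹ j) (N ℕ.* M))) (blocks N))
    where
    M = 2 ℕ.^ j
    r = q j ⁻¹
    a = quasi j
    blocks : ∀ k → S r a (k ℕ.* M) + r ^ (k ℕ.* M) ≈ 1#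
    blocks zero    = +-identityˡ 1#
    blocks (suc k) = begin-equality
      S r a (M ℕ.+ k ℕ.* M) + r ^ (M ℕ.+ k ℕ.* M)
        ≈⟨ +-cong (S-split r a M (k ℕ.* M)) (^-homo-* r M (k ℕ.* M)) ⟩
      S r a M + r ^ M * S r (shift M a) (k ℕ.* M) + r ^ M * r ^ (k ℕ.* M)
        ≡⟨ ≡.cong (λ s → S r a M + r ^ M * s + r ^ M * r ^ (k ℕ.* M))
             (S-cong r (quasi-shift j) (k ℕ.* M)) ⟩
      S r a M + r ^ M * S r a (k ℕ.* M) + r ^ M * r ^ (k ℕ.* M)
        ≈⟨ solve 4 (λ s p t u → s :+ p :* t :+ p :* u := s :+ p :* (t :+ u))
             refl (S r a M) (r ^ M) (S r a (k ℕ.* M)) (r ^ (k ℕ.* M)) ⟩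
      S r a M + r ^ M * (S r a (k ℕ.* M) + r ^ (k ℕ.* M))
        ≈⟨ +-congˡ (trans (*-congˡ (blocks k)) (*-identityʳ _)) ⟩
      S r a M + r ^ M
        ≈⟨ S-quasi-block j ⟩
      1# ∎

  zeroTails⇒S≤1 : ∀ j → ZeroTails (quasi j) d →
                  ∀ k → d k ≡ false → ∀ N → S (q j ⁻¹) (shift (suc k) d) N ≤ 1#
  zeroTails⇒S≤1 j tails k dₖ≡0 =
    S-ZeroTails (0<q⁻¹ j) (S-quasi≤1 j) (ZeroTails-shift (suc k) tails) (tails k dₖ≡0)

  module _ {t : Carrier} (1<t : 1# < t) where
    open Base 1<t

    zeroTails⇒small : ∀ j → q j < t → ZeroTails (quasi j) d → SmallZeroTails d
    zeroTails⇒small {d} j qⱼ<t tails k dₖ≡0 = ≤-<-trans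
      (val≤ _ (scaled-bound (0<q j) qⱼ<t (zeroTails⇒S≤1 j tails k dₖ≡0)))
      (<-respˡ-≈ (sym (*-identityʳ _)) (⁻¹*<1 (0<q j) qⱼ<t))

    admissible⇒unique : ∀ j → q j < t → Admissible (quasi j) d → Unique d
    admissible⇒unique j qⱼ<t (tails , tails′) =
      small⇒unique (zeroTails⇒small j qⱼ<t tails) (zeroTails⇒small j qⱼ<t tails′)

    small⇒smaller : ∀ {p} → (1<p : 1# < p) → p ≤ t → Base.SmallZeroTails 1<p d → SmallZeroTails d
    small⇒smaller {d} {p} 1<p p≤t small k dₖ≡0 = ≤-<-trans
      (val≤ _ λ N → ≤-trans
        (S-monoˡ 0<t⁻¹ (⁻¹-anti-≤ (0<base 1<p) p≤t) (shift (suc k) d) N)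
        (Base.S≤val 1<p (shift (suc k) d) N))
      (small k dₖ≡0)

  1<q : ∀ j → 1# < q (suc j)
  1<q j = 1<qₙ (suc j) (s≤s z≤n)

  private module Q (j : ℕ) = Base (1<q j)

  -- Periodicity multiplies the gap 1 - v by r^M < 1 while leaving it unchanged, so the gap cannot
  -- be positive.
  1≤val-quasi : ∀ j → 1# ≤ Q.val j (quasi (suc j))
  1≤val-quasi j = ≮⇒≥ λ v<1 → irrefl refl (begin-strict
    1# - v         ≈⟨ gap ⟩
    r ^ M * (1# - v) <⟨ *-monoˡ-< (x<y⇒0<y-x v<1) r^M<1 ⟩
    1# * (1# - v)  ≈⟨ *-identityˡ _ ⟩
    1# - v         ∎)
    where
    open Q j
    M = 2 ℕ.^ suc j
    r = q (suc j) ⁻¹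
    a = quasi (suc j)
    v = val a
    r^M<1 : r ^ M < 1#
    r^M<1 = power<1 M (ℕ.m^n>0 2 (suc j))
      where
      power≤1 : ∀ n → r ^ n ≤ 1#
      power≤1 zero    = ≤-refl
      power≤1 (suc n) = ≤-trans (*-monoʳ-≤ (<⇒≤ 0<t⁻¹) (power≤1 n))
        (≤-trans (≈⇒≤ (*-identityʳ r)) (<⇒≤ t⁻¹<1))
      power<1 : ∀ n → 1 ℕ.≤ n → r ^ n < 1#
      power<1 (suc n) _ = ≤-<-trans (*-monoʳ-≤ (<⇒≤ 0<t⁻¹) (power≤1 n))
        (<-respˡ-≈ (sym (*-identityʳ r)) t⁻¹<1)
    gap : 1# - v ≈ r ^ M * (1# - v)
    gap = begin-equality
      1# - v
        ≈⟨ +-cong (S-quasi-block (suc j)) (-‿cong (trans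
             (+-congˡ (*-congˡ (sym (val-cong (quasi-shift (suc j)))))) (sym (val-split a M)))) ⟨
      S r a M + r ^ M - (S r a M + r ^ M * v)
        ≈⟨ solve 3 (λ s p v → s :+ p :- (s :+ p :* v) := p :* (:1 :- v)) refl (S r a M) (r ^ M) v ⟩
      r ^ M * (1# - v) ∎

  module _ {t : Carrier} (1<t : 1# < t) (t<2 : t < 2#) where
    open Base 1<t

    private
      -- Tails behind a 0 are small in base t, hence also in the larger base `q (suc j)`. There
      -- `quasi (suc j)` has value at least 1 and serves as the comparison sequence.
      unique⇒strict : ∀ j → t ≤ q (suc j) → Unique d → StrictZeroTails (quasi (suc j)) d
      unique⇒strict j t≤Q unique = Q.small⇒strict j
        (S-quasi≤1 (suc j)) (quasi-zeroTails em (suc j)) (1≤val-quasi j)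
        (small⇒smaller (1<q j) 1<t t≤Q (Greedy.unique⇒small (1≤ω t<2) unique))

    unique⇒admissible : ∀ j → t ≤ q (suc j) → Unique d → Admissible (quasi j) d
    unique⇒admissible j t≤Q unique =
      strict⇒admissible j (unique⇒strict j t≤Q unique) (unique⇒strict j t≤Q (unique-flip unique))

  window-cover : ∀ {t} → 1# < t → ∀ j → t ≤ q j → ∃[ k ] 1 ℕ.≤ k × k ℕ.≤ j × t ∈ Window q k
  window-cover 1<t zero    t≤q = contradiction 1<t (≤⇒≯ (≤-trans t≤q (≈⇒≤ q₀≈1)))
  window-cover {t} 1<t (suc j) t≤q with ≤-or-> t (q j)
  ... | inj₂ qⱼ<t = suc j , s≤s z≤n , ℕ.≤-refl , qⱼ<t , t≤q
  ... | inj₁ t≤qⱼ with window-cover 1<t j t≤qⱼ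
  ...   | k , 1≤k , k≤j , t∈ = k , 1≤k , ℕ.≤-trans k≤j (ℕ.n≤1+n j) , t∈

-- The smallest candidate

module SmallestCandidate (em : ExcludedMiddle 0ℓ) (R : CompleteOrderedField)
  (q : ℕ → CompleteOrderedField.Carrier R) (critical : Expansions.IsCriticalBases R q)
  (j : ℕ) {x : CompleteOrderedField.Carrier R} where
  open OrderedField R
  open PartialSums R
  open LimitTheory em R
  open UniqueExpansions em R
  open CriticalBases em R q critical
  open Expansions R using (digit; 𝒰; Candidate)
  open Expansions.IsCriticalBases critical using (qₙ<2)
  open Reasoning

  private
    a = quasi j
    r = q j ⁻¹

  -- The candidates in combinatorial form: unique expansion in base `q (suc j)` becomes
  -- admissibility, and the possibly infinite value becomes one large partial sum.
  Exceeding : Pred BinarySeq 0ℓ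
  Exceeding d = Admissible a d × ∃[ N ] x < S r d N

  candidate⇒exceeding : ∀ {d} → Candidate q (suc j) x d → d ∈ Exceeding
  candidate⇒exceeding {d} ((y , (_ , _ , has) , exp) , exceeds) =
    unique⇒admissible (1<q j) (qₙ<2 (suc j) (s≤s z≤n)) j ≤-refl unique ,
    value>⇒sum> (0<q j) exceeds
    where
    open Base (1<q j)
    unique : Unique d
    unique c eq i = ≡.trans (≡.sym (unique₀ d (trans (expansion⇒val exp) (sym eq₀)) i))
      (unique₀ c (trans eq (trans (expansion⇒val exp) (sym eq₀))) i)
      where
      eq₀ = proj₁ (proj₂ (unique-elim has))
      unique₀ = proj₂ (proj₂ (unique-elim has))

  exceeding⇒candidate : q j < q (suc j) → ∀ {d} → d ∈ Exceeding → Candidate q (suc j) x d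
  exceeding⇒candidate q< {d} (adm , exceeds) =
    (val d , 𝒰-intro (unique-intro
         refl (admissible⇒unique (1<q j) j q< adm)) , val⇒expansion refl) ,
    sum>⇒value> (0<q j) exceeds
    where open Base (1<q j)

  open LexInfimum em Exceeding renaming (infimum to γ)

  infimum-≤ : ∀ {d} → d ∈ Exceeding → γ ≤ₗₑₓ d
  infimum-≤ {d} d∈ with lex-compare em γ d
  ... | inj₁ γ≗d        = inj₂ γ≗d
  ... | inj₂ (inj₁ γ<d) = inj₁ γ<d
  ... | inj₂ (inj₂ d<γ) = contradiction d<γ (lowerBound d∈)

  module _ (inhabited : ∃ Exceeding) where

    γ-admissible : Admissible a γ
    γ-admissible =
      ZeroTails-closed (λ k → let (d , (adm , _) , agree) = approximation inhabited k in
        d , proj₁ adm , agree) ,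
      ZeroTails-closed (λ k → let (d , (adm , _) , agree) = approximation inhabited k in
        flip d , proj₂ adm , λ i i<k → ≡.cong not (agree i i<k))

    module _ (γ-below : ∀ N → S r γ N ≤ x) where
      private
        -- The members of `Exceeding` that approximate γ differ from it, because the sums of γ stay
        -- at or below x; being at least γ, they lie strictly above.
        above : ∀ k → ∃[ d ] d ∈ Exceeding × Agree k γ d × γ <ₗₑₓ d
        above k with approximation inhabited k
        ... | d , d∈@(_ , N , x<S) , agree with infimum-≤ d∈
        ...   | inj₁ γ<d = d , d∈ , agree , γ<d
        ...   | inj₂ γ≗d = contradiction x<S
                  (≤⇒≯ (≤-trans (≈⇒≤ (reflexive (S-cong r (λ i → ≡.sym (γ≗d i)) N))) (γ-below N)))

        -- A larger admissible `d` sharing the first k + 1 digits of γ has a larger tail behind the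
        -- same 0. If the tail of γ were already `a`, that of `d` would exceed `a`.
        γ-isolated : ∀ k → γ k ≡ false → ¬ shift (suc k) γ ≗ a
        γ-isolated k γₖ≡0 eq with above (suc k)
        ... | d , ((tails , _) , _) , agree , γ<d =
          tails k (≡.trans (≡.sym (agree k ℕ.≤-refl)) γₖ≡0)
            (<ₗₑₓ-resp eq (λ _ → ≡.refl) (<ₗₑₓ-shift (suc k) agree γ<d))

        strict-at : ∀ k d → ZeroTails a d → d k ≡ false → ¬ shift (suc k) d ≗ a → shift (suc k) d <ₗₑₓ a
        strict-at k d tails dₖ≡0 ≇ with lex-compare em (shift (suc k) d) a
        ... | inj₁ eq        = contradiction eq ≇
        ... | inj₂ (inj₁ lt) = lt
        ... | inj₂ (inj₂ gt) = contradiction gt (tails k dₖ≡0)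

        γ-strict : StrictZeroTails a γ
        γ-strict k γₖ≡0 = strict-at k γ (proj₁ γ-admissible) γₖ≡0 (γ-isolated k γₖ≡0)

      -- For j = 0 the sequence `a` is 0^∞, and nothing lies strictly below it, so γ cannot begin
      -- with 0. If γ begins with 1, the tail condition on its complement forces γ = 1^∞, and
      -- nothing lies above that.
      j≢0 : ¬ j ≡ 0
      j≢0 ≡.refl with bool-split (γ 0)
      ... | inj₁ γ₀≡0 = contradiction (<⇒true (proj₂ (proj₂ (γ-strict 0 γ₀≡0)))) λ ()
      ... | inj₂ γ₀≡1 with above 0
      ...   | d , _ , _ , (k , _ , γₖ<dₖ) with k | lex-compare em (shift 1 (flip γ)) a
      ...     | zero   | _ = false≢true (<⇒false γₖ<dₖ) γ₀≡1
      ...     | suc k′ | inj₁ eq =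
                false≢true (≡.trans (≡.sym (≡.cong not (<⇒false γₖ<dₖ))) (eq k′)) ≡.refl
      ...     | suc k′ | inj₂ (inj₁ (_ , _ , lt)) = contradiction (<⇒true lt) λ ()
      ...     | suc k′ | inj₂ (inj₂ gt) = proj₂ γ-admissible 0 (≡.cong not γ₀≡1) gt

      γ-unique : (1<qⱼ : 1# < q j) → Base.Unique 1<qⱼ γ
      γ-unique 1<qⱼ = small⇒unique (small (proj₁ γ-admissible) γ-strict)
        (small (proj₂ γ-admissible) (flip-γ-strict j ≡.refl))
        where
        open Base 1<qⱼ
        M = 2 ℕ.^ j
        -- The digit 1 at place i recurs one period later, so a sum ending at place i still misses a
        -- positive term.
        S-quasi<1 : ∀ i → a i ≡ true → S r a (suc i) < 1#
        S-quasi<1 i aᵢ≡1 = begin-strict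
          S r a (suc i)
            ≤⟨ S-monoʳ 0<t⁻¹ a (ℕ.+-monoˡ-≤ i (ℕ.m^n>0 2 j)) ⟩
          S r a (M ℕ.+ i)
            <⟨ <-by (*-pos (^-pos 0<t⁻¹ (M ℕ.+ i)) (*-pos 0<t⁻¹ 0<1)) refl ⟩
          S r a (M ℕ.+ i) + r ^ (M ℕ.+ i) * (r * 1#)
            ≡⟨ ≡.cong (λ b → S r a (M ℕ.+ i) + r ^ (M ℕ.+ i) * (r * digit b))
                 (≡.trans (quasi-shift j i) aᵢ≡1) ⟨
          S r a (M ℕ.+ i) + r ^ (M ℕ.+ i) * (r * digit (a (M ℕ.+ i)))
            ≈⟨ S-suc r a (M ℕ.+ i) ⟨
          S r a (suc (M ℕ.+ i))
            ≤⟨ S-quasi≤1 j (suc (M ℕ.+ i)) ⟩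
          1# ∎
        -- In base `q j` itself tails have value at most 1. Strictness comes from the first
        -- difference: the value is at most a sum of `a` ending in a digit 1, which is less than 1.
        small : ∀ {d} → ZeroTails a d → StrictZeroTails a d → SmallZeroTails d
        small tails strictTails k dₖ≡0 =
          let e<a = strictTails k dₖ≡0
              (i , _ , eᵢ<aᵢ) = e<a
          in ≤-<-trans
            (val≤S e<a (val≤ _ (zeroTails⇒S≤1 j (ZeroTails-shift (suc k) tails) i (<⇒false eᵢ<aᵢ))))
            (S-quasi<1 i (<⇒true eᵢ<aᵢ))
        -- A complemented tail equal to `a` would, half a period later, give an uncomplemented tail
        -- of γ equal to `a`. The half period exists only for j ≥ 1, and the equation i ≡ j exposes
        -- j as a successor.
        flip-γ-strict : ∀ i → i ≡ j → StrictZeroTails a (flip γ)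
        flip-γ-strict zero    i≡j = contradiction (≡.sym i≡j) j≢0
        flip-γ-strict (suc i) i≡j k ¬γₖ≡0 = strict-at k (flip γ) (proj₂ γ-admissible) ¬γₖ≡0 λ eq →
          let (l , γₗ≡0 , eq′) = flipped-quasi-tail i {γ} k
                (≡.trans (≡.sym (not-involutive (γ k))) (≡.cong not ¬γₖ≡0))
                (λ m → ≡.trans (eq m) (≡.cong (λ n → quasi n m) (≡.sym i≡j)))
          in γ-isolated l γₗ≡0 (λ m → ≡.trans (eq′ m) (≡.cong (λ n → quasi n m) i≡j))

      x∈𝒰qⱼ : (1<qⱼ : 1# < q j) → x ∈ 𝒰 (q j)
      x∈𝒰qⱼ 1<qⱼ = 𝒰-intro (unique-intro
        (≤-antisym (val≤ γ γ-below) (≤-limit 0≤ω close)) (γ-unique 1<qⱼ))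
        where
        open Base 1<qⱼ
        -- Members of `Exceeding` have value above x and can agree with γ on k digits, so x exceeds
        -- the value of γ by at most the remainder after k digits.
        close : ∀ k → x ≤ val γ + r ^ k * ω
        close k = let (d , (_ , N , x<S) , agree) = approximation inhabited k in begin
          x                   ≤⟨ <⇒≤ x<S ⟩
          S r d N             ≤⟨ S≤val d N ⟩
          val d               ≤⟨ val≤S+ω d k ⟩
          S r d k + r ^ k * ω ≡⟨ ≡.cong (_+ r ^ k * ω) (S-agree r k agree) ⟨
          S r γ k + r ^ k * ω ≤⟨ +-monoˡ-≤ _ (S≤val γ k) ⟩
          val γ + r ^ k * ω   ∎

    γ-exceeding : (1# < q j → x ∉ 𝒰 (q j)) → γ ∈ Exceeding
    γ-exceeding x∉𝒰 with em {∃[ N ] x < S r γ N}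
    ... | yes exceeds = γ-admissible , exceeds
    ... | no  none    = contradiction (x∈𝒰qⱼ below (1<qⱼ j ≡.refl)) (x∉𝒰 (1<qⱼ j ≡.refl))
      where
      below : ∀ N → S r γ N ≤ x
      below N = ≮⇒≥ λ lt → none (N , lt)
      1<qⱼ : ∀ i → i ≡ j → 1# < q j
      1<qⱼ zero    0≡j = contradiction (≡.sym 0≡j) (j≢0 below)
      1<qⱼ (suc i) eq  = ≡.subst (λ k → 1# < q k) eq (1<q i)

-- The smallest base

module SmallestBase (em : ExcludedMiddle 0ℓ) (R : CompleteOrderedField)
  (q : ℕ → CompleteOrderedField.Carrier R) (critical : Expansions.IsCriticalBases R q)
  (j : ℕ) {x : CompleteOrderedField.Carrier R}
  (0<x : CompleteOrderedField._<_ R (CompleteOrderedField.0# R) x) where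
  open OrderedField R
  open PartialSums R
  open LimitTheory em R
  open Continuity em R
  open UniqueExpansions em R
  open CriticalBases em R q critical
  open SmallestCandidate em R q critical j {x}
  open Expansions R using (2#; IsExpansion; HasUniqueExpansion; UniqueBases; Window; 𝒟)
  open Expansions.IsCriticalBases critical using (qₙ<2)

  private
    Q = q (suc j)

    Q<2 : Q < 2#
    Q<2 = qₙ<2 (suc j) (s≤s z≤n)

  unique⇒exceeding : ∀ {t} (1<t : 1# < t) → q j < t → t ≤ Q →
                     ∀ d → Base.val 1<t d ≈ x → Base.Unique 1<t d → d ∈ Exceeding
  unique⇒exceeding 1<t qⱼ<t t≤Q d eq unique =
    unique⇒admissible 1<t (≤-<-trans t≤Q Q<2) j t≤Q unique ,
    smaller-base-exceeds (0<q j) qⱼ<t 0<x (IsLimit-resp eq (Base.val-isLimit 1<t d))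

  module _ {γ} (γ∈ : γ ∈ Exceeding) (γ-least : ∀ {d} → d ∈ Exceeding → γ ≤ₗₑₓ d) where
    private
      γ-val≤ : ∀ {t} (1<t : 1# < t) → q j < t → ∀ {d} → γ ≤ₗₑₓ d → Base.val 1<t γ ≤ Base.val 1<t d
      γ-val≤ 1<t qⱼ<t (inj₁ γ<d) =
        <⇒≤ (Base.val-mono-< 1<t (zeroTails⇒small 1<t j qⱼ<t (proj₁ (proj₁ γ∈))) γ<d)
      γ-val≤ 1<t qⱼ<t (inj₂ γ≗d) = ≈⇒≤ (Base.val-cong 1<t γ≗d)

    -- The unique expansion of x in base t belongs to `Exceeding`, hence is at least γ, and beyond
    -- `q j` this order passes to values.
    unique⇒S≤ : ∀ {t} (1<t : 1# < t) → q j < t → t ≤ Q → HasUniqueExpansion t x → ∀ N → S (t ⁻¹) γ N ≤ x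
    unique⇒S≤ {t} 1<t qⱼ<t t≤Q has N = bound (unique-elim has)
      where
      open Base 1<t
      bound : ∃[ d ] val d ≈ x × Unique d → S (t ⁻¹) γ N ≤ x
      bound (d , eq , unique) = ≤-trans (S≤val γ N) (≤-trans
        (γ-val≤ 1<t qⱼ<t (γ-least (unique⇒exceeding 1<t qⱼ<t t≤Q d eq unique))) (≈⇒≤ eq))

    solution : ∀ {t} → 1# < t → (∀ N → S (t ⁻¹) γ N ≤ x) →
               ∃[ qₛ ] q j < qₛ × qₛ ≤ t × IsLimit (qₛ ⁻¹) γ x
    -- The intermediate value argument runs over reciprocals of bases: at 1/t the sums stay at or
    -- below x, at the reciprocal of `q j` one of them exceeds x.
    solution {t} 1<t below = invert
      (intermediate-value γ (Base.0<t⁻¹ 1<t) below (q⁻¹≤1 j) (0<q⁻¹ j) (proj₂ γ∈))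
      where
      invert : ∃[ s ] t ⁻¹ ≤ s × s < q j ⁻¹ × IsLimit s γ x →
               ∃[ qₛ ] q j < qₛ × qₛ ≤ t × IsLimit (qₛ ⁻¹) γ x
      invert (s , t⁻¹≤s , s<q⁻¹ , limit) =
        s ⁻¹ ,
        <-respˡ-≈ (⁻¹-involutive (0<q j)) (⁻¹-anti-< 0<s s<q⁻¹) ,
        ≤-trans (⁻¹-anti-≤ (Base.0<t⁻¹ 1<t) t⁻¹≤s) (≈⇒≤ (⁻¹-involutive (0<base 1<t))) ,
        IsLimit-base (sym (⁻¹-involutive 0<s)) limit
        where
        0<s : 0# < s
        0<s = <-≤-trans (Base.0<t⁻¹ 1<t) t⁻¹≤s

    module _ {qₛ} (qⱼ<qₛ : q j < qₛ) (qₛ≤Q : qₛ ≤ Q) (γ-limit : IsLimit (qₛ ⁻¹) γ x) where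
      private
        1<qₛ : 1# < qₛ
        1<qₛ = ≤-<-trans (1≤q j) qⱼ<qₛ

      solution-expansion : IsExpansion qₛ x γ
      solution-expansion = IsLimit⇒HasValue (0<base 1<qₛ) γ-limit

      solution∈UniqueBases : qₛ ∈ UniqueBases x
      solution∈UniqueBases = 1<qₛ , ≤-<-trans qₛ≤Q Q<2 ,
        Base.unique-intro 1<qₛ (Base.expansion⇒val 1<qₛ solution-expansion)
          (admissible⇒unique 1<qₛ j qⱼ<qₛ (proj₁ γ∈))

      private
        solution≤ : ∀ {t} → 1# < t → (∀ N → S (t ⁻¹) γ N ≤ x) → qₛ ≤ t
        solution≤ {t} 1<t below = ≮⇒≥ λ t<qₛ →
          let (N , x<S) = smaller-base-exceeds (0<base 1<t) t<qₛ 0<x γ-limit in ≤⇒≯ (below N) x<S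

      solution-unique : ∀ t → q j < t → IsExpansion t x γ → t ≈ qₛ
      solution-unique t qⱼ<t exp = ≤-antisym
        (≮⇒≥ λ qₛ<t → let (N , x<S) = smaller-base-exceeds (0<base 1<qₛ) qₛ<t 0<x limit in
          ≤⇒≯ (proj₁ γ-limit N) x<S)
        (solution≤ 1<t (proj₁ limit))
        where
        1<t : 1# < t
        1<t = ≤-<-trans (1≤q j) qⱼ<t
        limit : IsLimit (t ⁻¹) γ x
        limit = HasValue⇒IsLimit (0<base 1<t) exp

      -- A base of uniqueness up to `Q` lies in some window. The earlier windows are excluded by
      -- hypothesis, and in the last one the sums of γ are at most x, so the base is not below `qₛ`.
      solution-lowerBound : (∀ k → 1 ℕ.≤ k → k ℕ.< suc j → x ∉ 𝒟 q k) →
                            ∀ {t} → t ∈ UniqueBases x → qₛ ≤ t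
      solution-lowerBound x∉𝒟 {t} (1<t , t<2 , has) with ≤-or-> t Q
      ... | inj₂ Q<t = ≤-trans qₛ≤Q (<⇒≤ Q<t)
      ... | inj₁ t≤Q with window-cover 1<t (suc j) t≤Q
      ...   | k , 1≤k , k≤n , window with ℕ.m≤n⇒m<n∨m≡n k≤n
      ...     | inj₁ k<n    = contradiction (t , window , Base.𝒰-intro 1<t has) (x∉𝒟 k 1≤k k<n)
      ...     | inj₂ ≡.refl = solution≤ 1<t (unique⇒S≤ 1<t (proj₁ window) t≤Q has)

theorem5p2 : ExcludedMiddle 0ℓ →
    (R : CompleteOrderedField) → let open Expansions R in
    (q : ℕ → Carrier) → IsCriticalBases q →
    (n : ℕ) → 1 ℕ.≤ n →
    (x : Carrier) → 0# < x →
    x ∈ 𝒟 q n → (∀ k → 1 ℕ.≤ k → k ℕ.< n → x ∉ 𝒟 q k) →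
    ∃[ qₛ ] IsInfimum (UniqueBases x) qₛ ×
    qₛ ∈ Window q n ×
    (∃[ γ ] IsLexSmallest (Candidate q n x) γ ×
    IsExpansion qₛ x γ ×
    (∀ p → p ∈ Window q n → IsExpansion p x γ → p ≈ qₛ))
theorem5p2 em R q critical (suc j) _ x 0<x (p , (qⱼ<p , p≤Q) , (_ , _ , has)) x∉𝒟 =
  smallestBase (solution {γ} γ∈ infimum-≤ 1<p (unique⇒S≤ {γ} γ∈ infimum-≤ 1<p qⱼ<p p≤Q has))
  where
  open OrderedField R
  open LimitTheory em R
  open Expansions R using (IsExpansion; UniqueBases; Window; Candidate)
  open UniqueExpansions em R
  open CriticalBases em R q critical
  open SmallestCandidate em R q critical j {x}
  open SmallestBase em R q critical j 0<x
  open LexInfimum em Exceeding renaming (infimum to γ)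
  1<p : 1# < p
  1<p = ≤-<-trans (1≤q j) qⱼ<p

  inhabited : ∃ Exceeding
  inhabited = let (d , eq , unique) = Base.unique-elim 1<p has in
    d , unique⇒exceeding 1<p qⱼ<p p≤Q d eq unique

  γ∈ : γ ∈ Exceeding
  -- The base `q j` lies itself in a window of index at most j, so unique expansion of x there would
  -- put x into an earlier `𝒟`.
  γ∈ = γ-exceeding inhabited λ 1<qⱼ x∈𝒰 →
    let (k , 1≤k , k≤j , window) = window-cover 1<qⱼ j ≤-refl in
    x∉𝒟 k 1≤k (s≤s k≤j) (q j , window , x∈𝒰)

  smallestBase : ∃[ qₛ ] q j < qₛ × qₛ ≤ p × IsLimit (qₛ ⁻¹) γ x →
    ∃[ qₛ ] IsInfimum (UniqueBases x) qₛ × qₛ ∈ Window q (suc j) ×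
      (∃[ γ ] IsLexSmallest (Candidate q (suc j) x) γ × IsExpansion qₛ x γ ×
        (∀ p → p ∈ Window q (suc j) → IsExpansion p x γ → p ≈ qₛ))
  smallestBase (qₛ , qⱼ<qₛ , qₛ≤p , limit) =
    qₛ ,
    (solution-lowerBound {γ} γ∈ infimum-≤ {qₛ} qⱼ<qₛ qₛ≤Q limit x∉𝒟 ,
     -- The infimum is attained: `qₛ` is itself a base of uniqueness.
     λ isLower → isLower (solution∈UniqueBases {γ} γ∈ infimum-≤ {qₛ} qⱼ<qₛ qₛ≤Q limit)) ,
    (qⱼ<qₛ , qₛ≤Q) ,
    γ ,
    -- The inequality between the two critical bases comes from the base p in the window between
    -- them.
    (exceeding⇒candidate (<-≤-trans qⱼ<p p≤Q) {γ} γ∈ ,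
     λ d d∈ → infimum-≤ {d} (candidate⇒exceeding {d} d∈)) ,
    solution-expansion {γ} γ∈ infimum-≤ {qₛ} qⱼ<qₛ qₛ≤Q limit ,
    λ t (qⱼ<t , _) → solution-unique {γ} γ∈ infimum-≤ {qₛ} qⱼ<qₛ qₛ≤Q limit t qⱼ<t
    where
    qₛ≤Q : qₛ ≤ q (suc j)
    qₛ≤Q = ≤-trans qₛ≤p p≤Q
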